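{- Let $n\ge 3$ and consider the affine Weyl group $W_{\mathrm{aff}}$ of type $A_{n-1}^{(1)}$, with $c=\alpha_0+\alpha_1+\dots+\alpha_{n-1}$ and $\Pi$ the finite root system of type $A_{n-1}$. Then: (1) $\Gamma_c(id)=\{t_\gamma:\gamma\in\Pi\}$; (2) $|\Gamma_c(id)|=n(n-1)$; (3) $\ell(w)=2(n-1)$ for all $w\in\Gamma_c(id)$.
   Context: Roots. Let $n\ge 3$. Let $\alpha_0,\dots,\alpha_{n-1}$ (indices mod $n$) be the affine simple roots of type $A_{n-1}^{(1)}$, $Q_{\mathrm{aff}}=\bigoplus_{i=0}^{n-1}\mathbb Z\alpha_i$, with symmetric form $\langle\alpha_i,\alpha_i\rangle=2$, $\langle\alpha_i,\alpha_{i\pm1}\rangle=-1$, all other $\langle\alpha_i,\alpha_j\rangle=0$. Put $c=\sum_{i=0}^{n-1}\alpha_i$ (identified with the imaginary root $\delta$). Let $\Pi=\Pi^+\sqcup\Pi^-$ be the finite root system of type $A_{n-1}$ with simple roots $\alpha_1,\dots,\alpha_{n-1}$. The affine real roots are $\alpha+mc$ with $\alpha\in\Pi$, $m\in\mathbb Z$; such a root is positive if $m>0$, or $m=0$ and $\alpha\in\Pi^+$. The set of positive real roots is $\Pi_{\mathrm{aff}}^{\mathrm{re},+}$. Weyl group. For a real root $\alpha$, $s_\alpha(\mu)=\mu-\langle\mu,\alpha\rangle\alpha$. $W_{\mathrm{aff}}$ is the group generated by $s_i=s_{\alpha_i}$, $0\le i\le n-1$ (a Coxeter group with these generators), with length $\ell$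 and Bruhat order $\le$. One has $W_{\mathrm{aff}}=W\ltimes Q$, where $W=\langle s_1,\dots,s_{n-1}\rangle$ and $Q=\bigoplus_{i=1}^{n-1}\mathbb Z\alpha_i$ (root and coroot lattices identified); $t_\mu$ denotes the image of $\mu\in Q$, with $s_{\alpha+mc}=s_\alpha t_{m\alpha}$ for $\alpha\in\Pi$, $m\in\mathbb Z$ (so $t_\mu(\nu)=\nu-\langle\mu,\nu\rangle c$). Curve neighborhoods. The moment graph has vertex set $W_{\mathrm{aff}}$ and an edge $u\stackrel{\alpha}{\longrightarrow}us_\alpha$ of degree $\alpha$ for each $u\in W_{\mathrm{aff}}$, $\alpha\in\Pi_{\mathrm{aff}}^{\mathrm{re},+}$. The degree of a chain (a succession of adjacent edges, possibly empty) is the sum of the degrees of its edges. A degree is a tuple $\mathbf d=(d_0,\dots,d_{n-1})\in\mathbb Z_{\ge0}^n$, identified with $\sum d_i\alpha_i$; degrees are ordered componentwise. For $u\in W_{\mathrm{aff}}$, $\Gamma_{\mathbf d}(u)$ is the set of Bruhat-maximal elements of the set of all $v\in W_{\mathrm{aff}}$ that can be joined to some $u'\le u$ by a chain of degree $\le\mathbf d$. -}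

module Defs where

open import Level using (0ℓ)
import Algebra.Properties.Semiring.Sum
open import Data.Bool.Base using (if_then_else_; _∧_; _∨_)
open import Data.Fin.Base using (Fin; toℕ)
open import Data.Fin.Properties using (_≟_)
open import Data.Integer.Base as ℤ using (ℤ; +_; 0ℤ; 1ℤ; -1ℤ)
open import Data.Integer.Properties using (+-*-semiring)
open import Data.List.Base using (List; []; _∷_; length)
open import Data.Nat.Base using (ℕ; suc; _≤_; _<_)
open import Data.Nat.DivMod using (_mod_)
open import Data.Nat.Properties using (_≤?_)
open import Data.Product.Base using (∃; ∃-syntax; _×_; proj₁)
open import Data.Sum.Base using (_⊎_)
open import Data.Vec.Base using (Vec; lookup; map; replicate; tabulate; zipWith)
open import Data.Vec.Relation.Binary.Pointwise.Inductive using (Pointwise)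
open import Function.Base using (id; _∘_)
open import Function.Bundles using (Bijection)
open import Relation.Binary.Bundles using (Setoid)
import Relation.Binary.Construct.On as On
open import Relation.Binary.PropositionalEquality
  using (_≡_; _≗_; setoid; _→-setoid_)
open import Relation.Nullary.Decidable.Core using (does)
open import Relation.Unary using (Pred; _∈_)

open Algebra.Properties.Semiring.Sum +-*-semiring using (sum-syntax)

private
  variable
    n : ℕ

------------------------------------------------------------------------
-- The affine root lattice

-- Coordinates are taken in the basis α₀, …, αₙ₋₁.
Qaff : ℕ → Set
Qaff n = Vec ℤ n

infixl 6 _⊕_ _⊖_
infixr 7 _⊛_

_⊕_ _⊖_ : Qaff n → Qaff n → Qaff n
_⊕_ = zipWith ℤ._+_
_⊖_ = zipWith ℤ._-_

_⊛_ : ℤ → Qaff n → Qaff n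
k ⊛ μ = map (k ℤ.*_) μ

𝟎 : Qaff n
𝟎 = replicate _ 0ℤ

α : Fin n → Qaff n
α i = tabulate λ k → if does (k ≟ i) then 1ℤ else 0ℤ

-- The imaginary root δ = α₀ + ⋯ + αₙ₋₁.
c : Qaff n
c = replicate _ 1ℤ

next : Fin n → Fin n
next {suc m} i = suc (toℕ i) mod suc m

-- The Gram matrix ⟨αᵢ , αⱼ⟩; this is the form of type A⁽¹⁾ₙ₋₁ only for n ≥ 3
-- (for n = 2 the off-diagonal entries would have to be -2).
gram : Fin n → Fin n → ℤ
gram i j =
  if does (i ≟ j) then + 2
  else if does (j ≟ next i) ∨ does (i ≟ next j) then -1ℤ
  else 0ℤ

⟨_,_⟩ : Qaff n → Qaff n → ℤ
⟨_,_⟩ {n} μ ν =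
  ∑[ i < n ] ∑[ j < n ] (lookup μ i ℤ.* gram i j ℤ.* lookup ν j)

------------------------------------------------------------------------
-- Roots

-- αᵢ + αᵢ₊₁ + ⋯ + αⱼ, without wrapping around.
interval : Fin n → Fin n → Qaff n
interval i j = tabulate λ k →
  if does (toℕ i ≤? toℕ k) ∧ does (toℕ k ≤? toℕ j) then 1ℤ else 0ℤ

-- The finite roots of type A with simple roots α₁, …, αₙ₋₁:
-- ε_i - ε_{j+1} = αᵢ + ⋯ + αⱼ for 1 ≤ i ≤ j ≤ n-1, and their negatives.
Π⁺ Π⁻ Π : Pred (Qaff n) 0ℓ
Π⁺ β = ∃[ i ] ∃[ j ] 1 ≤ toℕ i × toℕ i ≤ toℕ j × β ≡ interval i j
Π⁻ β = ∃[ γ ] γ ∈ Π⁺ × β ≡ map ℤ.-_ γ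
Π  β = β ∈ Π⁺ ⊎ β ∈ Π⁻

Πaff-re⁺ : Pred (Qaff n) 0ℓ
Πaff-re⁺ β =
  ∃[ γ ] ∃[ m ] γ ∈ Π × (0ℤ ℤ.< m ⊎ m ≡ 0ℤ × γ ∈ Π⁺) × β ≡ γ ⊕ m ⊛ c

------------------------------------------------------------------------
-- The affine Weyl group

-- The affine Weyl group is realised as a set of self-maps of the affine root
-- lattice; its elements are compared by pointwise equality _≗_, and the group
-- operation is composition.
Map : ℕ → Set
Map n = Qaff n → Qaff n

s : Qaff n → Map n
s β μ = μ ⊖ ⟨ μ , β ⟩ ⊛ β

t : Qaff n → Map n
t μ ν = ν ⊖ ⟨ μ , ν ⟩ ⊛ c

word : List (Fin n) → Map n
word []       = id
word (i ∷ is) = s (α i) ∘ word is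

-- The generators are involutions, so no inverse letters are needed.
Waff : Pred (Map n) 0ℓ
Waff w = ∃[ is ] w ≗ word is

-- HasLength w k says that w ∈ Waff and ℓ(w) = k.
HasLength : Map n → ℕ → Set
HasLength w k =
  (∃[ is ] length is ≡ k × w ≗ word is) ×
  (∀ is → w ≗ word is → k ≤ length is)

-- The Bruhat order: the preorder generated by u ≤ u s_β for real roots β with
-- ℓ(u) < ℓ(u s_β).  As s_β = s_{-β}, positive roots suffice.
infix 4 _≤ᴮ_

data _≤ᴮ_ {n} (u v : Map n) : Set where
  done : u ≗ v → u ≤ᴮ v
  step : ∀ {β u′ k l} → β ∈ Πaff-re⁺ → u′ ≗ u ∘ s β →
         HasLength u k → HasLength u′ l → k < l →
         u′ ≤ᴮ v → u ≤ᴮ v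

------------------------------------------------------------------------
-- Curve neighbourhoods

Edge : Map n → Qaff n → Map n → Set
Edge u β v = u ∈ Waff × v ∈ Waff × β ∈ Πaff-re⁺ × v ≗ u ∘ s β

-- Chain u v e: a chain of adjacent edges from u to v with degree e.
data Chain {n} (u v : Map n) : Qaff n → Set where
  []  : u ≗ v → Chain u v 𝟎
  _∷_ : ∀ {β u′ e} → Edge u β u′ → Chain u′ v e → Chain u v (β ⊕ e)

Degree : ℕ → Set
Degree n = Vec ℕ n

toQaff : Degree n → Qaff n
toQaff = map +_

-- c as a degree.
𝐜 : Degree n
𝐜 = replicate _ 1

infix 4 _≤Q_

_≤Q_ : Qaff n → Qaff n → Set
_≤Q_ = Pointwise ℤ._≤_

Reachable : Degree n → Map n → Pred (Map n) 0ℓ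
Reachable d u v =
  v ∈ Waff ×
  ∃[ u′ ] u′ ∈ Waff × u′ ≤ᴮ u × ∃[ e ] Chain u′ v e × e ≤Q toQaff d

Γ : Degree n → Map n → Pred (Map n) 0ℓ
Γ d u v =
  v ∈ Reachable d u × (∀ v′ → v′ ∈ Reachable d u → v ≤ᴮ v′ → v ≗ v′)

------------------------------------------------------------------------
-- Cardinality of a set of maps, taken up to pointwise equality

subsetSetoid : Pred (Map n) 0ℓ → Setoid 0ℓ 0ℓ
subsetSetoid {n} P = On.setoid {B = ∃ P} (Qaff n →-setoid Qaff n) proj₁

HasCardinality : Pred (Map n) 0ℓ → ℕ → Set
HasCardinality P k = Bijection (setoid (Fin k)) (subsetSetoid P)

{-# OPTIONS --safe #-}
-- Modulo c a root is determined by the differences of its cyclically consecutive coefficients, and these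
-- form the vector ε_a - ε_b of two distinct unit vectors.  A chain of degree ≤ c from id is a product of
-- reflections in positive roots with pairwise disjoint supports.  Such a product goes up in the Bruhat
-- order when the reflection in a simple root outside all supports is put in front of it, and when two
-- factors s_β, s_γ with ⟨β,γ⟩ = -1 are merged into s_{β+γ} = s_β s_γ s_β.  While at least three roots of
-- sum c remain, a merge is possible, so every product lies below some s_β s_γ with β + γ = c, which is the
-- translation t_γ.  A positive root of height h ≤ n - 1 below c is reached by adding one simple root at a
-- time; this gives a reduced palindromic word of length 2h - 1 for its reflection, and the words of β and γ
-- concatenate to a reduced word, so all these t_γ have length 2(n - 1).  Having the same length, they are
-- pairwise incomparable, hence exactly the maximal elements.

module Submission where

open import Defs
open import Data.Nat.Base using (ℕ; _≤_; _*_; _∸_)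
open import Data.Product.Base using (_×_; ∃-syntax)
open import Function.Base using (id)
open import Relation.Binary.PropositionalEquality using (_≗_)
open import Relation.Unary using (_∈_; _≐_)

import Algebra.Properties.Semiring.Sum
open import Data.Bool.Base using (true; false; if_then_else_; _∧_)
open import Data.Fin.Base using (Fin; zero; suc; toℕ; inject₁; fromℕ; combine; remQuot; punchIn; punchOut)
open import Data.Fin.Induction using (<-weakInduction)
open import Data.Fin.Permutation.Components using (transpose; transpose-inverse)
import Data.Fin.Properties as Fin
open import Data.Fin.Properties using (_≟_)
open import Data.Fin.Relation.Unary.Top using (view; ‵fromℕ; ‵inject₁)
open import Data.Integer.Base as ℤ using (ℤ; +_; 0ℤ; 1ℤ; -1ℤ)
import Data.Integer.Properties as ℤ
open import Data.Integer.Tactic.RingSolver using (solve-∀)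
open import Data.List.Base using (List; []; _∷_; length; _++_; allFin)
open import Data.List.Membership.Propositional.Properties using (∈-allFin)
open import Data.List.Properties using (length-++)
open import Data.List.Relation.Unary.All as All using (All; []; _∷_)
open import Data.List.Relation.Unary.AllPairs using (AllPairs; []; _∷_)
open import Data.Nat.Base as ℕ using (zero; suc)
open import Data.Nat.DivMod using (m<n⇒m%n≡m; n%n≡0)
import Data.Nat.Properties as ℕ
open import Data.Product.Base using (_,_; proj₁; proj₂)
open import Data.Product.Properties using (,-injectiveˡ; ,-injectiveʳ)
open import Data.Sum.Base as Sum using (_⊎_; inj₁; inj₂)
import Data.Vec.Base as Vec
open import Data.Vec.Base using (lookup; map)
open import Data.Vec.Properties
  using (lookup-zipWith; lookup-map; lookup-replicate; lookup∘tabulate; tabulate∘lookup; tabulate-cong)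
open import Data.Vec.Relation.Binary.Pointwise.Inductive as Pointwise using ()
open import Function.Base using (_∘_)
open import Relation.Binary.Definitions using (tri<; tri≈; tri>)
open import Relation.Binary.PropositionalEquality
  using (_≡_; _≢_; refl; sym; trans; cong; cong₂; subst; subst₂; module ≡-Reasoning)
open import Relation.Nullary.Decidable using (Dec; yes; no; does; dec-true; dec-false)
open import Relation.Nullary.Negation.Core using (¬_; contradiction)

open Algebra.Properties.Semiring.Sum ℤ.+-*-semiring
  using (sum; sum-syntax; sum-cong-≗; sum-init-last; ∑-distrib-+; ∑-comm)

-- Bruhat steps multiply on the right and must exhibit lengths, while group elements are bare maps
-- without inverses. Hence lengths are built along words, from one fact: `w s_β` is longer than `w`
-- when `w β` is positive. A reflection `s_μ` put in front of a product `w` is rewritten as `w s_ν`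
-- with `w ν = μ`, and the disjointness of the supports is what makes `ν` positive. A merge is
-- available for a reason of weights. From `⟨ c , β ⟩ = 0` and `⟨ β , β ⟩ = 2` the other roots pair
-- with `β` to -2 in total, so some single pairing is nonzero. Disjoint supports make every pairing
-- nonpositive. A single pairing equal to -2 would force the two roots to add up to a multiple of
-- `c`, covering every index, which the support of a third root forbids. So the nonzero pairing is
-- -1, exactly the case in which the sum is again a root.

private
  variable
    n : ℕ

-- Coordinates in the affine root lattice.

ext : {μ ν : Qaff n} → (∀ k → lookup μ k ≡ lookup ν k) → μ ≡ ν
ext {μ = μ} {ν} eq = trans (sym (tabulate∘lookup μ)) (trans (tabulate-cong eq) (tabulate∘lookup ν))

⊕-at : (μ ν : Qaff n) (k : Fin n) → lookup (μ ⊕ ν) k ≡ lookup μ k ℤ.+ lookup ν k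
⊕-at μ ν k = lookup-zipWith ℤ._+_ k μ ν

⊖-at : (μ ν : Qaff n) (k : Fin n) → lookup (μ ⊖ ν) k ≡ lookup μ k ℤ.- lookup ν k
⊖-at μ ν k = lookup-zipWith ℤ._-_ k μ ν

⊛-at : (a : ℤ) (μ : Qaff n) (k : Fin n) → lookup (a ⊛ μ) k ≡ a ℤ.* lookup μ k
⊛-at a μ k = lookup-map k (a ℤ.*_) μ

neg-at : (μ : Qaff n) (k : Fin n) → lookup (map ℤ.-_ μ) k ≡ ℤ.- lookup μ k
neg-at μ k = lookup-map k ℤ.-_ μ

c-at : (k : Fin n) → lookup c k ≡ 1ℤ
c-at k = lookup-replicate k 1ℤ

𝟎-at : (k : Fin n) → lookup 𝟎 k ≡ 0ℤ
𝟎-at k = lookup-replicate k 0ℤ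

⊖⊛-at : ∀ (μ : Qaff n) a ν k → lookup (μ ⊖ a ⊛ ν) k ≡ lookup μ k ℤ.- a ℤ.* lookup ν k
⊖⊛-at μ a ν k = trans (⊖-at μ (a ⊛ ν) k) (cong (ℤ._-_ (lookup μ k)) (⊛-at a ν k))

⊕-comm : (μ ν : Qaff n) → μ ⊕ ν ≡ ν ⊕ μ
⊕-comm μ ν = ext λ k → trans (⊕-at μ ν k) (trans (ℤ.+-comm (lookup μ k) _) (sym (⊕-at ν μ k)))

⊕-identityʳ : (μ : Qaff n) → μ ⊕ 𝟎 ≡ μ
⊕-identityʳ μ = ext λ k → trans (⊕-at μ 𝟎 k) (trans (cong (ℤ._+_ (lookup μ k)) (𝟎-at k)) (ℤ.+-identityʳ _))

-- Kronecker deltas and finite sums.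

δ : Fin n → Fin n → ℤ
δ a k = if does (k ≟ a) then 1ℤ else 0ℤ

δ-refl : (a : Fin n) → δ a a ≡ 1ℤ
δ-refl a rewrite dec-true (a ≟ a) refl = refl

δ-≢ : {a k : Fin n} → k ≢ a → δ a k ≡ 0ℤ
δ-≢ {a = a} {k} k≢a rewrite dec-false (k ≟ a) k≢a = refl

0≤δ : (a k : Fin n) → 0ℤ ℤ.≤ δ a k
0≤δ a k with k ≟ a
... | yes _ = ℤ.+≤+ ℕ.z≤n
... | no  _ = ℤ.+≤+ ℕ.z≤n

δ≤1 : (a k : Fin n) → δ a k ℤ.≤ 1ℤ
δ≤1 a k with k ≟ a
... | yes _ = ℤ.+≤+ (ℕ.s≤s ℕ.z≤n)
... | no  _ = ℤ.+≤+ ℕ.z≤n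

α-at : (i k : Fin n) → lookup (α i) k ≡ δ i k
α-at i k = lookup∘tabulate (δ i) k

sum-0 : (f : Fin n → ℤ) → (∀ k → f k ≡ 0ℤ) → sum f ≡ 0ℤ
sum-0 {zero} f eq = refl
sum-0 {suc n} f eq = cong₂ ℤ._+_ (eq zero) (sum-0 (f ∘ suc) (eq ∘ suc))

sum-δ : (f : Fin n → ℤ) (a : Fin n) → ∑[ k < n ] (f k ℤ.* δ a k) ≡ f a
sum-δ f zero = trans (cong₂ ℤ._+_ (ℤ.*-identityʳ (f zero)) (sum-0 _ λ k → ℤ.*-zeroʳ (f (suc k))))
    (ℤ.+-identityʳ (f zero))
sum-δ f (suc a) = trans (cong₂ ℤ._+_ (ℤ.*-zeroʳ (f zero)) (sum-δ (f ∘ suc) a)) (ℤ.+-identityˡ _)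

sum-≤0 : (f : Fin n → ℤ) → (∀ k → f k ℤ.≤ 0ℤ) → sum f ℤ.≤ 0ℤ
sum-≤0 {zero} f le = ℤ.≤-refl
sum-≤0 {suc n} f le = ℤ.+-mono-≤ (le zero) (sum-≤0 (f ∘ suc) (le ∘ suc))

-- The cyclic successor of an index.

next-inject₁ : {m : ℕ} (i : Fin m) → next (inject₁ i) ≡ suc i
next-inject₁ {m} i = Fin.toℕ-injective (trans (Fin.toℕ-fromℕ< _)
  (trans (m<n⇒m%n≡m (ℕ.s≤s (ℕ.≤-trans (ℕ.≤-reflexive (cong suc (Fin.toℕ-inject₁ i))) (Fin.toℕ<n i))))
         (cong suc (Fin.toℕ-inject₁ i))))

next-fromℕ : (m : ℕ) → next (fromℕ m) ≡ zero
next-fromℕ m = Fin.toℕ-injective (trans (Fin.toℕ-fromℕ< _)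
  (trans (cong (λ x → suc x ℕ.% suc m) (Fin.toℕ-fromℕ m)) (n%n≡0 (suc m))))

next-injective : {i j : Fin n} → next i ≡ next j → i ≡ j
next-injective {suc m} {i} {j} eq with view i | view j
... | ‵fromℕ     | ‵fromℕ     = refl
... | ‵fromℕ     | ‵inject₁ j′ = contradiction (trans (sym (next-fromℕ m)) (trans eq (next-inject₁ j′))) λ ()
... | ‵inject₁ i′ | ‵fromℕ     = contradiction (trans (sym (next-fromℕ m)) (trans (sym eq) (next-inject₁ i′))) λ ()
... | ‵inject₁ i′ | ‵inject₁ j′ =
    cong inject₁ (Fin.suc-injective (trans (sym (next-inject₁ i′)) (trans eq (next-inject₁ j′))))

next-surjective : (i : Fin n) → ∃[ j ] next j ≡ i
next-surjective {suc n} zero    = fromℕ n , next-fromℕ n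
next-surjective {suc n} (suc i) = inject₁ i , next-inject₁ i

δ-next : (i k : Fin n) → δ (next i) (next k) ≡ δ i k
δ-next i k with k ≟ i
... | yes refl = δ-refl (next k)
... | no k≢i  = δ-≢ (k≢i ∘ next-injective)

toℕ-next : {m : ℕ} (i : Fin (suc m)) →
  toℕ (next i) ≡ suc (toℕ i) ⊎ (toℕ i ≡ m × toℕ (next i) ≡ 0)
toℕ-next {m} i with view i
... | ‵fromℕ      = inj₂ (Fin.toℕ-fromℕ m , cong toℕ (next-fromℕ m))
... | ‵inject₁ i′ = inj₁ (trans (cong toℕ (next-inject₁ i′)) (cong suc (sym (Fin.toℕ-inject₁ i′))))

next-≢ : 3 ≤ n → (i : Fin n) → i ≢ next i
next-≢ (ℕ.s≤s (ℕ.s≤s _)) i eq with toℕ-next i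
... | inj₁ e        = ℕ.1+n≢n (trans (sym e) (sym (cong toℕ eq)))
... | inj₂ (e , e′) = contradiction (trans (sym e) (trans (cong toℕ eq) e′)) λ ()

next²-≢ : 3 ≤ n → (i : Fin n) → i ≢ next (next i)
next²-≢ (ℕ.s≤s (ℕ.s≤s (ℕ.s≤s _))) i eq with toℕ-next i | toℕ-next (next i)
... | inj₁ e        | inj₁ f        = ℕ.<-irrefl (trans (cong toℕ eq) (trans f (cong suc e)))
    (ℕ.m<n⇒m<1+n (ℕ.n<1+n _))
... | inj₁ e        | inj₂ (f , f′) = contradiction (trans (sym f) (trans e (cong suc (trans (cong toℕ eq) f′))))
    λ ()
... | inj₂ (e , e′) | inj₁ f        = contradiction (trans (sym e) (trans (cong toℕ eq) (trans f (cong suc e′))))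
    λ ()
... | inj₂ (e , e′) | inj₂ (f , f′) = contradiction (trans (sym f) e′) λ ()

-- The form as a scalar product of cyclic differences.

sum-next : (f : Fin n → ℤ) → sum (f ∘ next) ≡ sum f
sum-next {zero}  f = refl
sum-next {suc m} f = begin
  sum (f ∘ next)                                        ≡⟨ sum-init-last (f ∘ next) ⟩
  sum (λ i → f (next (inject₁ i))) ℤ.+ f (next (fromℕ m))
    ≡⟨ cong₂ ℤ._+_ (sum-cong-≗ λ i → cong f (next-inject₁ i)) (cong f (next-fromℕ m)) ⟩
  sum (f ∘ suc) ℤ.+ f zero                              ≡⟨ ℤ.+-comm (sum (f ∘ suc)) (f zero) ⟩
  sum f                                                 ∎
  where open ≡-Reasoning

-- This is the map to the standard lattice given by `α_i ↦ ε_i - ε_{i-1}`, indices cyclic. Its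
-- kernel is spanned by `c`, and `form-D` identifies the form with the standard scalar product of
-- the images.
D : Qaff n → Fin n → ℤ
D μ k = lookup μ k ℤ.- lookup μ (next k)

-- Replaces nested conditionals by a sum, to which summation by parts applies. The three tests have
-- to exclude each other, and here `n ≥ 3` enters: for `n = 2` the other index is both successor and
-- predecessor.
gram-δ : 3 ≤ n → (i j : Fin n) →
  gram i j ≡ (+ 2) ℤ.* δ j i ℤ.- δ (next i) j ℤ.- δ (next j) i
gram-δ 3≤n i j with i ≟ j | j ≟ next i | i ≟ next j
... | yes refl | yes q | _     = contradiction q (next-≢ 3≤n i)
... | yes refl | no _ | yes q  = contradiction q (next-≢ 3≤n i)
... | yes _ | no _  | no _     = refl
... | no _ | yes refl | yes q  = contradiction q (next²-≢ 3≤n i)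
... | no _ | yes _ | no _      = refl
... | no _ | no _  | yes _     = refl
... | no _ | no _  | no _      = refl

-- Summation by parts: the left-hand side is 2 Σ xᵢ yᵢ - Σ xᵢ y_{σ i} - Σ x_{σ i} yᵢ.
cyclic-form : (σ : Fin n → Fin n) → (∀ f → sum (f ∘ σ) ≡ sum f) → (x y : Fin n → ℤ) →
  sum (λ i → sum λ j → x i ℤ.* ((+ 2) ℤ.* δ j i ℤ.- δ (σ i) j ℤ.- δ (σ j) i) ℤ.* y j) ≡
  sum (λ k → (x k ℤ.- x (σ k)) ℤ.* (y k ℤ.- y (σ k)))
cyclic-form {n} σ sum-σ x y = begin
  _ ≡⟨ sum-cong-≗ (λ i → sum-cong-≗ λ j → expand (x i) (y j) (δ j i) (δ (σ i) j) (δ (σ j) i)) ⟩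
  sum (λ i → sum λ j → A i j ℤ.+ (B i j ℤ.+ C i j)) ≡⟨ sum-cong-≗ (λ i → ∑-distrib-+ (A i) λ j → B i j ℤ.+ C i j) ⟩
  sum (λ i → sum (A i) ℤ.+ sum (λ j → B i j ℤ.+ C i j))
    ≡⟨ ∑-distrib-+ (λ i → sum (A i)) (λ i → sum (λ j → B i j ℤ.+ C i j)) ⟩
  sum (λ i → sum (A i)) ℤ.+ sum (λ i → sum (λ j → B i j ℤ.+ C i j))
    ≡⟨ cong (ℤ._+_ (sum (λ i → sum (A i))))
        (trans (sum-cong-≗ λ i → ∑-distrib-+ (B i) (C i)) (∑-distrib-+ (λ i → sum (B i)) (λ i → sum (C i)))) ⟩
  sum (λ i → sum (A i)) ℤ.+ (sum (λ i → sum (B i)) ℤ.+ sum (λ i → sum (C i)))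
    ≡⟨ cong₂ ℤ._+_ (trans (∑-comm A) (sum-cong-≗ λ j → sum-δ (λ i → (+ 2) ℤ.* (x i ℤ.* y j)) j))
        (cong₂ ℤ._+_ (sum-cong-≗ λ i → sum-δ (λ j → ℤ.- (x i ℤ.* y j)) (σ i))
                     (trans (∑-comm C) (sum-cong-≗ λ j → sum-δ (λ i → ℤ.- (x i ℤ.* y j)) (σ j)))) ⟩
  sum (λ k → (+ 2) ℤ.* S k) ℤ.+ (sum E ℤ.+ sum F)
    ≡⟨ cong (ℤ._+ (sum E ℤ.+ sum F))
        (trans (sum-cong-≗ λ k → double (S k)) (trans (∑-distrib-+ S S) (cong (ℤ._+_ (sum S)) (sym (sum-σ S))))) ⟩
  (sum S ℤ.+ sum (S ∘ σ)) ℤ.+ (sum E ℤ.+ sum F)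
    ≡⟨ cong₂ ℤ._+_ (∑-distrib-+ S (S ∘ σ)) (∑-distrib-+ E F) ⟨
  sum (λ k → S k ℤ.+ S (σ k)) ℤ.+ sum (λ k → E k ℤ.+ F k)
    ≡⟨ ∑-distrib-+ (λ k → S k ℤ.+ S (σ k)) (λ k → E k ℤ.+ F k) ⟨
  sum (λ k → (S k ℤ.+ S (σ k)) ℤ.+ (E k ℤ.+ F k)) ≡⟨ sum-cong-≗ (λ k → collect (x k) (x (σ k)) (y k) (y (σ k))) ⟩
  sum (λ k → (x k ℤ.- x (σ k)) ℤ.* (y k ℤ.- y (σ k))) ∎
  where
  open ≡-Reasoning
  S E F : Fin n → ℤ
  S k = x k ℤ.* y k
  E k = ℤ.- (x k ℤ.* y (σ k))
  F k = ℤ.- (x (σ k) ℤ.* y k)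
  A B C : Fin n → Fin n → ℤ
  A i j = (+ 2) ℤ.* (x i ℤ.* y j) ℤ.* δ j i
  B i j = ℤ.- (x i ℤ.* y j) ℤ.* δ (σ i) j
  C i j = ℤ.- (x i ℤ.* y j) ℤ.* δ (σ j) i
  expand : ∀ x y a b c → x ℤ.* ((+ 2) ℤ.* a ℤ.- b ℤ.- c) ℤ.* y ≡
    (+ 2) ℤ.* (x ℤ.* y) ℤ.* a ℤ.+ (ℤ.- (x ℤ.* y) ℤ.* b ℤ.+ ℤ.- (x ℤ.* y) ℤ.* c)
  expand = solve-∀
  double : ∀ x → (+ 2) ℤ.* x ≡ x ℤ.+ x
  double = solve-∀
  collect : ∀ x x′ y y′ → (x ℤ.* y ℤ.+ x′ ℤ.* y′) ℤ.+ (ℤ.- (x ℤ.* y′) ℤ.+ ℤ.- (x′ ℤ.* y)) ≡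
      (x ℤ.- x′) ℤ.* (y ℤ.- y′)
  collect = solve-∀

form-D : 3 ≤ n → (μ ν : Qaff n) → ⟨ μ , ν ⟩ ≡ sum (λ k → D μ k ℤ.* D ν k)
form-D 3≤n μ ν = trans
  (sum-cong-≗ λ i → sum-cong-≗ λ j → cong (λ g → lookup μ i ℤ.* g ℤ.* lookup ν j) (gram-δ 3≤n i j))
  (cyclic-form next sum-next (lookup μ) (lookup ν))

sum-linear : (f g h : Fin n → ℤ) (a : ℤ) →
  sum (λ k → (f k ℤ.- a ℤ.* g k) ℤ.* h k) ≡ sum (λ k → f k ℤ.* h k) ℤ.- a ℤ.* sum (λ k → g k ℤ.* h k)
sum-linear {zero} f g h a = sym (zero-case a)
  where
  zero-case : ∀ a → 0ℤ ℤ.- a ℤ.* 0ℤ ≡ 0ℤ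
  zero-case = solve-∀
sum-linear {suc n} f g h a = trans
  (cong (ℤ._+_ ((f zero ℤ.- a ℤ.* g zero) ℤ.* h zero)) (sum-linear (f ∘ suc) (g ∘ suc) (h ∘ suc) a))
  (collect (f zero) (g zero) (h zero) a (sum (λ k → f (suc k) ℤ.* h (suc k)))
      (sum (λ k → g (suc k) ℤ.* h (suc k))))
  where
  collect : ∀ f g h a x y → (f ℤ.- a ℤ.* g) ℤ.* h ℤ.+ (x ℤ.- a ℤ.* y) ≡ (f ℤ.* h ℤ.+ x) ℤ.- a ℤ.* (g ℤ.* h ℤ.+ y)
  collect = solve-∀

-- The shape `μ ⊖ a ⊛ β` is that of a reflection. Addition (`a = -1`) and negation (`μ = 𝟎`) are
-- instances of it, so linearity is always stated for this one operation.
D-⊖⊛ : (μ : Qaff n) (a : ℤ) (β : Qaff n) (k : Fin n) → D (μ ⊖ a ⊛ β) k ≡ D μ k ℤ.- a ℤ.* D β k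
D-⊖⊛ μ a β k = trans (cong₂ ℤ._-_ (⊖⊛-at μ a β k) (⊖⊛-at μ a β (next k)))
  (collect (lookup μ k) (lookup μ (next k)) a (lookup β k) (lookup β (next k)))
  where
  collect : ∀ x x′ a y y′ → (x ℤ.- a ℤ.* y) ℤ.- (x′ ℤ.- a ℤ.* y′) ≡ (x ℤ.- x′) ℤ.- a ℤ.* (y ℤ.- y′)
  collect = solve-∀

D-c : (k : Fin n) → D c k ≡ 0ℤ
D-c k = trans (cong₂ ℤ._-_ (c-at k) (c-at (next k))) refl

⊕-⊖⊛ : (μ ν : Qaff n) → μ ⊕ ν ≡ μ ⊖ -1ℤ ⊛ ν
⊕-⊖⊛ μ ν = ext λ k → trans (⊕-at μ ν k) (trans (minus-minus (lookup μ k) (lookup ν k)) (sym (⊖⊛-at μ -1ℤ ν k)))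
  where
  minus-minus : ∀ x y → x ℤ.+ y ≡ x ℤ.- -1ℤ ℤ.* y
  minus-minus = solve-∀

neg-⊖⊛ : (ν : Qaff n) → map ℤ.-_ ν ≡ 𝟎 ⊖ 1ℤ ⊛ ν
neg-⊖⊛ ν = ext λ k → trans (neg-at ν k)
    (trans (minus (lookup ν k)) (trans (cong (ℤ._- (1ℤ ℤ.* lookup ν k)) (sym (𝟎-at k))) (sym (⊖⊛-at 𝟎 1ℤ ν k))))
  where
  minus : ∀ y → ℤ.- y ≡ 0ℤ ℤ.- 1ℤ ℤ.* y
  minus = solve-∀

D-𝟎 : (k : Fin n) → D 𝟎 k ≡ 0ℤ
D-𝟎 k = cong₂ ℤ._-_ (𝟎-at k) (𝟎-at (next k))

D-⊕ : (μ ν : Qaff n) (k : Fin n) → D (μ ⊕ ν) k ≡ D μ k ℤ.+ D ν k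
D-⊕ μ ν k = trans (cong (λ ρ → D ρ k) (⊕-⊖⊛ μ ν)) (trans (D-⊖⊛ μ -1ℤ ν k) (collect (D μ k) (D ν k)))
  where
  collect : ∀ x y → x ℤ.- -1ℤ ℤ.* y ≡ x ℤ.+ y
  collect = solve-∀

D-neg : (ν : Qaff n) (k : Fin n) → D (map ℤ.-_ ν) k ≡ ℤ.- D ν k
D-neg ν k = trans (cong (λ ρ → D ρ k) (neg-⊖⊛ ν))
    (trans (D-⊖⊛ 𝟎 1ℤ ν k) (trans (cong (ℤ._- (1ℤ ℤ.* D ν k)) (D-𝟎 k)) (minus (D ν k))))
  where
  minus : ∀ y → 0ℤ ℤ.- 1ℤ ℤ.* y ≡ ℤ.- y
  minus = solve-∀

D≡0⇒constant : (μ : Qaff n) → (∀ k → D μ k ≡ 0ℤ) → ∀ k l → lookup μ k ≡ lookup μ l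
D≡0⇒constant {suc n} μ eq k l = trans (constant k) (sym (constant l))
  where
  constant : ∀ k → lookup μ k ≡ lookup μ zero
  constant = <-weakInduction _ refl λ i ih →
    trans (cong (lookup μ) (sym (next-inject₁ i)))
      (trans (sym (ℤ.i-j≡0⇒i≡j (lookup μ (inject₁ i)) (lookup μ (next (inject₁ i))) (eq (inject₁ i)))) ih)

D≡0⇒⊛c : (μ : Qaff (suc n)) → (∀ k → D μ k ≡ 0ℤ) → μ ≡ lookup μ zero ⊛ c
D≡0⇒⊛c μ eq = ext λ k → trans (D≡0⇒constant μ eq k zero) (sym (trans (⊛-at (lookup μ zero) c k)
    (trans (cong (ℤ._*_ (lookup μ zero)) (c-at k)) (ℤ.*-identityʳ (lookup μ zero)))))

-- Roots as vectors with differences of the form ε_a - ε_b.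

Nonneg Nonpos : Qaff n → Set
Nonneg μ = ∀ k → 0ℤ ℤ.≤ lookup μ k
Nonpos μ = ∀ k → lookup μ k ℤ.≤ 0ℤ

-- These are the vectors γ + m c with γ ∈ Π, see root-split.
record IsRoot (β : Qaff n) : Set where
  constructor root
  field
    {a b} : Fin n
    a≢b   : a ≢ b
    D-eq  : ∀ k → D β k ≡ δ a k ℤ.- δ b k

-- The left side is the reflection in `ε_a - ε_b` applied to the unit vector `ε_p`. Reflections thus
-- permute unit vectors, which is why they map roots to roots in `s-root`.
δ-transpose : {a b : Fin n} → a ≢ b → ∀ p k →
  δ p k ℤ.- (δ p a ℤ.- δ p b) ℤ.* (δ a k ℤ.- δ b k) ≡ δ (transpose a b p) k
δ-transpose {a = a} {b} a≢b p k with p ≟ a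
... | yes refl = trans (cong₂ (λ x y → δ a k ℤ.- (x ℤ.- y) ℤ.* (δ a k ℤ.- δ b k)) (δ-refl a) (δ-≢ (a≢b ∘ sym)))
    (case-a (δ a k) (δ b k))
  where
  case-a : ∀ x y → x ℤ.- (1ℤ ℤ.- 0ℤ) ℤ.* (x ℤ.- y) ≡ y
  case-a = solve-∀
... | no p≢a with p ≟ b
...   | yes refl = trans (cong₂ (λ x y → δ b k ℤ.- (x ℤ.- y) ℤ.* (δ a k ℤ.- δ b k)) (δ-≢ a≢b) (δ-refl b))
    (case-b (δ a k) (δ b k))
  where
  case-b : ∀ x y → y ℤ.- (0ℤ ℤ.- 1ℤ) ℤ.* (x ℤ.- y) ≡ x
  case-b = solve-∀
...   | no p≢b = trans (cong₂ (λ x y → δ p k ℤ.- (x ℤ.- y) ℤ.* (δ a k ℤ.- δ b k)) (δ-≢ (p≢a ∘ sym))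
    (δ-≢ (p≢b ∘ sym))) (case-p (δ p k) (δ a k) (δ b k))
  where
  case-p : ∀ z x y → z ℤ.- (0ℤ ℤ.- 0ℤ) ℤ.* (x ℤ.- y) ≡ z
  case-p = solve-∀

neg-root : {β : Qaff n} → IsRoot β → IsRoot (map ℤ.-_ β)
neg-root {β = β} (root {a} {b} a≢b eq) = root (a≢b ∘ sym) λ k →
  trans (D-neg β k) (trans (cong ℤ.-_ (eq k)) (swap (δ a k) (δ b k)))
  where
  swap : ∀ x y → ℤ.- (x ℤ.- y) ≡ y ℤ.- x
  swap = solve-∀

root-D : {β : Qaff n} ((root {a} {b} _ _) : IsRoot β) → D β a ≡ 1ℤ × D β b ≡ -1ℤ
root-D (root {a} {b} a≢b eq) =
  trans (eq a) (cong₂ ℤ._-_ (δ-refl a) (δ-≢ a≢b)) , trans (eq b) (cong₂ ℤ._-_ (δ-≢ (a≢b ∘ sym)) (δ-refl b))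

¬root-D≡0 : {β : Qaff n} → IsRoot β → ¬ (∀ k → D β k ≡ 0ℤ)
¬root-D≡0 r@(root {a} _ _) eq = contradiction (trans (sym (eq a)) (proj₁ (root-D r))) λ ()

¬root-0 : {β : Qaff n} → IsRoot β → ¬ (Nonneg β × Nonpos β)
¬root-0 {β = β} r (β≥0 , β≤0) = ¬root-D≡0 r λ k → cong₂ ℤ._-_ (β≡0 k) (β≡0 (next k))
  where
  β≡0 : ∀ k → lookup β k ≡ 0ℤ
  β≡0 k = ℤ.≤-antisym (β≤0 k) (β≥0 k)

-- Finite roots as intervals

-- A delta and an interval are both differences of two such step functions. This common primitive
-- turns the computation of `D` on an interval into cancellation.
unit-step : ℕ → ℕ → ℤ
unit-step x k = if does (x ℕ.≤? k) then 1ℤ else 0ℤ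

unit-step-≤ : {x k : ℕ} → x ℕ.≤ k → unit-step x k ≡ 1ℤ
unit-step-≤ {x} {k} x≤k rewrite dec-true (x ℕ.≤? k) x≤k = refl

unit-step-> : {x k : ℕ} → k ℕ.< x → unit-step x k ≡ 0ℤ
unit-step-> {x} {k} k<x rewrite dec-false (x ℕ.≤? k) (ℕ.<⇒≱ k<x) = refl

unit-step-suc : (x k : ℕ) → unit-step (suc x) (suc k) ≡ unit-step x k
unit-step-suc zero    k = refl
unit-step-suc (suc x) k = refl

δ-unit-step : (a k : Fin n) → δ a k ≡ unit-step (toℕ a) (toℕ k) ℤ.- unit-step (suc (toℕ a)) (toℕ k)
δ-unit-step a k with ℕ.<-cmp (toℕ a) (toℕ k)
... | tri< a<k a≢k _ = trans (δ-≢ (a≢k ∘ cong toℕ ∘ sym))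
    (sym (cong₂ ℤ._-_ (unit-step-≤ (ℕ.<⇒≤ a<k)) (unit-step-≤ a<k)))
... | tri≈ _ a≡k _ = trans (cong (δ a) (sym (Fin.toℕ-injective a≡k))) (trans (δ-refl a)
        (sym (cong₂ ℤ._-_ (unit-step-≤ (ℕ.≤-reflexive a≡k)) (unit-step-> (ℕ.s≤s (ℕ.≤-reflexive (sym a≡k)))))))
... | tri> _ a≢k k<a = trans (δ-≢ (a≢k ∘ cong toℕ ∘ sym))
    (sym (cong₂ ℤ._-_ (unit-step-> k<a) (unit-step-> (ℕ.m<n⇒m<1+n k<a))))

interval-at : (i j k : Fin n) → toℕ i ℕ.≤ toℕ j →
  lookup (interval i j) k ≡ unit-step (toℕ i) (toℕ k) ℤ.- unit-step (suc (toℕ j)) (toℕ k)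
interval-at i j k i≤j = trans (lookup∘tabulate _ k) (go (toℕ i ℕ.≤? toℕ k) (toℕ k ℕ.≤? toℕ j))
  where
  go : Dec (toℕ i ℕ.≤ toℕ k) → Dec (toℕ k ℕ.≤ toℕ j) →
    (if does (toℕ i ℕ.≤? toℕ k) ∧ does (toℕ k ℕ.≤? toℕ j) then 1ℤ else 0ℤ) ≡
    unit-step (toℕ i) (toℕ k) ℤ.- unit-step (suc (toℕ j)) (toℕ k)
  go (yes p) (yes q) rewrite dec-true (toℕ i ℕ.≤? toℕ k) p | dec-true (toℕ k ℕ.≤? toℕ j) q =
    sym (cong (ℤ._-_ 1ℤ) (unit-step-> (ℕ.s≤s q)))
  go (yes p) (no q) rewrite dec-true (toℕ i ℕ.≤? toℕ k) p | dec-false (toℕ k ℕ.≤? toℕ j) q =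
    sym (cong (ℤ._-_ 1ℤ) (unit-step-≤ (ℕ.≰⇒> q)))
  go (no p) _ rewrite dec-false (toℕ i ℕ.≤? toℕ k) p =
    sym (cong (ℤ._-_ 0ℤ) (unit-step-> (ℕ.m<n⇒m<1+n (ℕ.<-≤-trans (ℕ.≰⇒> p) i≤j))))

0≤interval : (i j k : Fin n) → 0ℤ ℤ.≤ lookup (interval i j) k
0≤interval i j k = subst (ℤ._≤_ 0ℤ) (sym (lookup∘tabulate _ k))
    (go (does (toℕ i ℕ.≤? toℕ k) ∧ does (toℕ k ℕ.≤? toℕ j)))
  where
  go : ∀ b → 0ℤ ℤ.≤ (if b then 1ℤ else 0ℤ)
  go true  = ℤ.+≤+ ℕ.z≤n
  go false = ℤ.+≤+ ℕ.z≤n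

interval≤1 : (i j k : Fin n) → lookup (interval i j) k ℤ.≤ 1ℤ
interval≤1 i j k = subst (ℤ._≤ 1ℤ) (sym (lookup∘tabulate _ k))
    (go (does (toℕ i ℕ.≤? toℕ k) ∧ does (toℕ k ℕ.≤? toℕ j)))
  where
  go : ∀ b → (if b then 1ℤ else 0ℤ) ℤ.≤ 1ℤ
  go true  = ℤ.+≤+ (ℕ.s≤s ℕ.z≤n)
  go false = ℤ.+≤+ ℕ.z≤n

interval-zero : (i : Fin n) (j : Fin (suc n)) → lookup (interval (suc i) j) zero ≡ 0ℤ
interval-zero i j = refl

-- The indicator falls just after its last index `j` and rises just after `inject₁ i`, the index
-- before its first. The wrap-around index needs its own case: its successor is `zero`, where the
-- interval vanishes because it starts at a successor.
D-interval : (i : Fin n) (j : Fin (suc n)) → suc (toℕ i) ℕ.≤ toℕ j →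
  ∀ k → D (interval (suc i) j) k ≡ δ j k ℤ.- δ (inject₁ i) k
D-interval {n} i j i<j k with view k
... | ‵fromℕ = begin
  D (interval (suc i) j) κ
    ≡⟨ cong₂ ℤ._-_ (interval-at (suc i) j κ i<j)
        (trans (cong (lookup (interval (suc i) j)) (next-fromℕ n)) (interval-zero i j)) ⟩
  (u (suc (toℕ i)) ℤ.- u (suc (toℕ j))) ℤ.- 0ℤ ≡⟨ cong (λ x → (x ℤ.- u (suc (toℕ j))) ℤ.- 0ℤ) (u≡1 (Fin.toℕ<n i)) ⟩
  (1ℤ ℤ.- u (suc (toℕ j))) ℤ.- 0ℤ
    ≡⟨ cong₂ (λ x y → (x ℤ.- u (suc (toℕ j))) ℤ.- y) (u≡1 (ℕ.≤-pred (Fin.toℕ<n j)))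
         (cong₂ ℤ._-_ (u≡1 (ℕ.≤-trans (ℕ.≤-reflexive (Fin.toℕ-inject₁ i)) (ℕ.<⇒≤ (Fin.toℕ<n i))))
                      (u≡1 (ℕ.≤-trans (ℕ.≤-reflexive (cong suc (Fin.toℕ-inject₁ i))) (Fin.toℕ<n i)))) ⟨
  (u (toℕ j) ℤ.- u (suc (toℕ j))) ℤ.- (u (toℕ (inject₁ i)) ℤ.- u (suc (toℕ (inject₁ i))))
    ≡⟨ cong₂ ℤ._-_ (δ-unit-step j κ) (δ-unit-step (inject₁ i) κ) ⟨
  δ j κ ℤ.- δ (inject₁ i) κ ∎
  where
  open ≡-Reasoning
  κ = fromℕ n
  u : ℕ → ℤ
  u x = unit-step x (toℕ κ)
  u≡1 : ∀ {x} → x ℕ.≤ n → u x ≡ 1ℤ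
  u≡1 x≤n = unit-step-≤ (ℕ.≤-trans x≤n (ℕ.≤-reflexive (sym (Fin.toℕ-fromℕ n))))
... | ‵inject₁ k′ = begin
  D (interval (suc i) j) κ ≡⟨ cong₂ ℤ._-_ (interval-at (suc i) j κ i<j)
      (trans (cong (lookup (interval (suc i) j)) (next-inject₁ k′)) (interval-at (suc i) j (suc k′) i<j)) ⟩
  (u (suc (toℕ i)) ℤ.- u (suc (toℕ j))) ℤ.-
    (unit-step (suc (toℕ i)) (suc (toℕ k′)) ℤ.- unit-step (suc (toℕ j)) (suc (toℕ k′)))
    ≡⟨ cong₂ (λ x y → (u (suc (toℕ i)) ℤ.- u (suc (toℕ j))) ℤ.- (x ℤ.- y)) (shift (toℕ i)) (shift (toℕ j)) ⟩
  (u (suc (toℕ i)) ℤ.- u (suc (toℕ j))) ℤ.- (u (toℕ i) ℤ.- u (toℕ j))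
    ≡⟨ collect (u (suc (toℕ i))) (u (suc (toℕ j))) (u (toℕ i)) (u (toℕ j)) ⟩
  (u (toℕ j) ℤ.- u (suc (toℕ j))) ℤ.- (u (toℕ i) ℤ.- u (suc (toℕ i)))
    ≡⟨ cong₂ ℤ._-_ (δ-unit-step j κ)
        (trans (δ-unit-step (inject₁ i) κ) (cong (λ x → u x ℤ.- u (suc x)) (Fin.toℕ-inject₁ i))) ⟨
  δ j κ ℤ.- δ (inject₁ i) κ ∎
  where
  open ≡-Reasoning
  κ = inject₁ k′
  u : ℕ → ℤ
  u x = unit-step x (toℕ κ)
  shift : ∀ x → unit-step (suc x) (suc (toℕ k′)) ≡ u x
  shift x = trans (unit-step-suc x (toℕ k′)) (cong (unit-step x) (sym (Fin.toℕ-inject₁ k′)))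
  collect : ∀ a b c d → (a ℤ.- b) ℤ.- (c ℤ.- d) ≡ (d ℤ.- b) ℤ.- (c ℤ.- a)
  collect = solve-∀

Π⁺-root : {γ : Qaff n} → γ ∈ Π⁺ → IsRoot γ
Π⁺-root {suc n} (suc i , j , _ , i<j , refl) = root
  (λ e → ℕ.<⇒≢ i<j (trans (sym (Fin.toℕ-inject₁ i)) (sym (cong toℕ e))))
  (D-interval i j i<j)

Π-root : {γ : Qaff n} → γ ∈ Π → IsRoot γ
Π-root (inj₁ γ∈Π⁺)              = Π⁺-root γ∈Π⁺
Π-root (inj₂ (γ′ , γ′∈Π⁺ , refl)) = neg-root (Π⁺-root γ′∈Π⁺)

Π⁺-zero : {γ : Qaff (suc n)} → γ ∈ Π⁺ → lookup γ zero ≡ 0ℤ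
Π⁺-zero (suc i , j , _ , _ , refl) = interval-zero i j

Π-zero : {γ : Qaff (suc n)} → γ ∈ Π → lookup γ zero ≡ 0ℤ
Π-zero (inj₁ γ∈Π⁺)              = Π⁺-zero γ∈Π⁺
Π-zero (inj₂ (γ′ , γ′∈Π⁺ , refl)) = trans (neg-at γ′ zero) (cong ℤ.-_ (Π⁺-zero γ′∈Π⁺))

Π⁺-D : (a b : Fin (suc n)) → toℕ b ℕ.< toℕ a → ∃[ γ ] (γ ∈ Π⁺ × ∀ k → D γ k ≡ δ a k ℤ.- δ b k)
Π⁺-D {n} a b b<a with view b
... | ‵fromℕ = contradiction (ℕ.<-≤-trans b<a (ℕ.≤-pred (Fin.toℕ<n a))) (ℕ.<-irrefl (Fin.toℕ-fromℕ n))
... | ‵inject₁ b′ = interval (suc b′) a , (suc b′ , a , ℕ.s≤s ℕ.z≤n , b′<a , refl) , D-interval b′ a b′<a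
  where
  b′<a : toℕ b′ ℕ.< toℕ a
  b′<a = subst (ℕ._< toℕ a) (Fin.toℕ-inject₁ b′) b<a

-- Converse to `Π-root`: every ordered pair of distinct indices is realised by a finite root. These
-- pairs are what `n(n-1)` counts.
Π-D : (a b : Fin n) → a ≢ b → ∃[ γ ] (γ ∈ Π × ∀ k → D γ k ≡ δ a k ℤ.- δ b k)
Π-D {suc n} a b a≢b with ℕ.<-cmp (toℕ b) (toℕ a)
... | tri< b<a _ _ = let γ , γ∈Π⁺ , eq = Π⁺-D a b b<a in γ , inj₁ γ∈Π⁺ , eq
... | tri≈ _ b≡a _ = contradiction (sym (Fin.toℕ-injective b≡a)) a≢b
... | tri> _ _ a<b = let γ , γ∈Π⁺ , eq = Π⁺-D b a a<b in
  map ℤ.-_ γ , inj₂ (γ , γ∈Π⁺ , refl) , λ k → trans (D-neg γ k) (trans (cong ℤ.-_ (eq k)) (swap (δ b k) (δ a k)))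
  where
  swap : ∀ x y → ℤ.- (x ℤ.- y) ≡ y ℤ.- x
  swap = solve-∀

⊕⊛c-at : (γ : Qaff n) (a : ℤ) (k : Fin n) → lookup (γ ⊕ a ⊛ c) k ≡ lookup γ k ℤ.+ a
⊕⊛c-at γ a k = trans (⊕-at γ (a ⊛ c) k) (cong (ℤ._+_ (lookup γ k))
  (trans (⊛-at a c k) (trans (cong (ℤ._*_ a) (c-at k)) (ℤ.*-identityʳ a))))

D-⊕⊛c : (γ : Qaff n) (a : ℤ) (k : Fin n) → D (γ ⊕ a ⊛ c) k ≡ D γ k
D-⊕⊛c γ a k = trans (cong₂ ℤ._-_ (⊕⊛c-at γ a k) (⊕⊛c-at γ a (next k))) (collect (lookup γ k) (lookup γ (next k)) a)
  where
  collect : ∀ x y a → (x ℤ.+ a) ℤ.- (y ℤ.+ a) ≡ x ℤ.- y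
  collect = solve-∀

-- Equal differences leave only a multiple of `c` undetermined, and since `ν` has no `α_0`-component
-- the multiple can be read off `μ` at `zero`.
≡-by-D : (μ ν : Qaff (suc n)) → (∀ k → D μ k ≡ D ν k) → lookup ν zero ≡ 0ℤ → μ ≡ ν ⊕ lookup μ zero ⊛ c
≡-by-D μ ν eq ν₀≡0 = ext λ k → begin
  lookup μ k ≡⟨ split (lookup μ k) (lookup ν k) ⟩
  lookup ν k ℤ.+ (lookup μ k ℤ.- 1ℤ ℤ.* lookup ν k) ≡⟨ cong (ℤ._+_ (lookup ν k)) (sym (⊖⊛-at μ 1ℤ ν k)) ⟩
  lookup ν k ℤ.+ lookup ρ k ≡⟨ cong (λ σ → lookup ν k ℤ.+ lookup σ k) (D≡0⇒⊛c ρ Dρ≡0) ⟩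
  lookup ν k ℤ.+ lookup (lookup ρ zero ⊛ c) k ≡⟨ cong (λ x → lookup ν k ℤ.+ lookup (x ⊛ c) k) ρ₀≡μ₀ ⟩
  lookup ν k ℤ.+ lookup (lookup μ zero ⊛ c) k ≡⟨ ⊕-at ν (lookup μ zero ⊛ c) k ⟨
  lookup (ν ⊕ lookup μ zero ⊛ c) k ∎
  where
  open ≡-Reasoning
  ρ = μ ⊖ 1ℤ ⊛ ν
  split : ∀ x y → x ≡ y ℤ.+ (x ℤ.- 1ℤ ℤ.* y)
  split = solve-∀
  Dρ≡0 : ∀ k → D ρ k ≡ 0ℤ
  Dρ≡0 k = trans (D-⊖⊛ μ 1ℤ ν k) (trans (cong (λ x → x ℤ.- 1ℤ ℤ.* D ν k) (eq k)) (cancel (D ν k)))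
    where
    cancel : ∀ x → x ℤ.- 1ℤ ℤ.* x ≡ 0ℤ
    cancel = solve-∀
  ρ₀≡μ₀ : lookup ρ zero ≡ lookup μ zero
  ρ₀≡μ₀ = trans (⊖⊛-at μ 1ℤ ν zero)
      (trans (cong (λ x → lookup μ zero ℤ.- 1ℤ ℤ.* x) ν₀≡0) (minus-0 (lookup μ zero)))
    where
    minus-0 : ∀ x → x ℤ.- 1ℤ ℤ.* 0ℤ ≡ x
    minus-0 = solve-∀

root-split : {β : Qaff (suc n)} → IsRoot β → ∃[ γ ] (γ ∈ Π × β ≡ γ ⊕ lookup β zero ⊛ c)
root-split {β = β} (root {a} {b} a≢b eq) = let γ , γ∈Π , eq′ = Π-D a b a≢b in
  γ , γ∈Π , ≡-by-D β γ (λ k → trans (eq k) (sym (eq′ k))) (Π-zero γ∈Π)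

Π⁺-bounds : {γ : Qaff n} → γ ∈ Π⁺ → ∀ k → 0ℤ ℤ.≤ lookup γ k × lookup γ k ℤ.≤ 1ℤ
Π⁺-bounds (i , j , _ , _ , refl) k = 0≤interval i j k , interval≤1 i j k

0≤+ : ∀ {x a} → 0ℤ ℤ.≤ x → 0ℤ ℤ.≤ a → 0ℤ ℤ.≤ x ℤ.+ a
0≤+ = ℤ.+-mono-≤

+≤0 : ∀ {x a} → x ℤ.≤ 0ℤ → a ℤ.≤ 0ℤ → x ℤ.+ a ℤ.≤ 0ℤ
+≤0 = ℤ.+-mono-≤

0≤-1+ : ∀ {x a} → -1ℤ ℤ.≤ x → 0ℤ ℤ.< a → 0ℤ ℤ.≤ x ℤ.+ a
0≤-1+ -1≤x 0<a = ℤ.+-mono-≤ -1≤x (ℤ.i<j⇒suc[i]≤j 0<a)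

1+≤0 : ∀ {x a} → x ℤ.≤ 1ℤ → a ℤ.< 0ℤ → x ℤ.+ a ℤ.≤ 0ℤ
1+≤0 x≤1 a<0 = ℤ.+-mono-≤ x≤1 (ℤ.i<j⇒i≤pred[j] a<0)

≤0-or->0 : ∀ a → a ℤ.≤ 0ℤ ⊎ 0ℤ ℤ.< a
≤0-or->0 (+ zero)   = inj₁ ℤ.≤-refl
≤0-or->0 (+ suc a)  = inj₂ (ℤ.+<+ (ℕ.s≤s ℕ.z≤n))
≤0-or->0 ℤ.-[1+ a ] = inj₁ ℤ.-≤+

<0-or-≥0 : ∀ a → a ℤ.< 0ℤ ⊎ 0ℤ ℤ.≤ a
<0-or-≥0 (+ a)      = inj₂ (ℤ.+≤+ ℕ.z≤n)
<0-or-≥0 ℤ.-[1+ a ] = inj₁ ℤ.-<+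

Π⁻-bounds : {γ : Qaff n} → γ ∈ Π⁻ → ∀ k → lookup γ k ℤ.≤ 0ℤ × -1ℤ ℤ.≤ lookup γ k
Π⁻-bounds (γ , γ∈Π⁺ , refl) k =
  subst (ℤ._≤ 0ℤ) (sym (neg-at γ k)) (ℤ.neg-mono-≤ (proj₁ (Π⁺-bounds γ∈Π⁺ k))) ,
  subst (ℤ._≤_ -1ℤ) (sym (neg-at γ k)) (ℤ.neg-mono-≤ (proj₂ (Π⁺-bounds γ∈Π⁺ k)))

Nonneg-⊕⊛c : (γ : Qaff n) (a : ℤ) → (∀ k → 0ℤ ℤ.≤ lookup γ k ℤ.+ a) → Nonneg (γ ⊕ a ⊛ c)
Nonneg-⊕⊛c γ a le k = ℤ.≤-trans (le k) (ℤ.≤-reflexive (sym (⊕⊛c-at γ a k)))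

Nonpos-⊕⊛c : (γ : Qaff n) (a : ℤ) → (∀ k → lookup γ k ℤ.+ a ℤ.≤ 0ℤ) → Nonpos (γ ⊕ a ⊛ c)
Nonpos-⊕⊛c γ a le k = ℤ.≤-trans (ℤ.≤-reflexive (⊕⊛c-at γ a k)) (le k)

Π⊕⊛c-sign : (γ : Qaff n) → γ ∈ Π → ∀ a → Nonneg (γ ⊕ a ⊛ c) ⊎ Nonpos (γ ⊕ a ⊛ c)
Π⊕⊛c-sign γ (inj₁ γ∈Π⁺) a with <0-or-≥0 a
... | inj₁ a<0 = inj₂ (Nonpos-⊕⊛c γ a λ k → 1+≤0 (proj₂ (Π⁺-bounds γ∈Π⁺ k)) a<0)
... | inj₂ 0≤a = inj₁ (Nonneg-⊕⊛c γ a λ k → 0≤+ (proj₁ (Π⁺-bounds γ∈Π⁺ k)) 0≤a)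
Π⊕⊛c-sign γ (inj₂ γ∈Π⁻) a with ≤0-or->0 a
... | inj₁ a≤0 = inj₂ (Nonpos-⊕⊛c γ a λ k → +≤0 (proj₁ (Π⁻-bounds γ∈Π⁻ k)) a≤0)
... | inj₂ 0<a = inj₁ (Nonneg-⊕⊛c γ a λ k → 0≤-1+ (proj₂ (Π⁻-bounds γ∈Π⁻ k)) 0<a)

root-sign : {β : Qaff n} → IsRoot β → Nonneg β ⊎ Nonpos β
root-sign {zero} (root {a = ()} _ _)
root-sign {suc n} {β} r = let γ , γ∈Π , β≡ = root-split r in
  subst (λ β → Nonneg β ⊎ Nonpos β) (sym β≡) (Π⊕⊛c-sign γ γ∈Π (lookup β zero))

-- Positivity by coordinates suits arguments about supports and heights. The two conversions below
-- show that it agrees with `Πaff-re⁺`.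
record PosRoot (β : Qaff n) : Set where
  constructor _,_
  field
    isRoot : IsRoot β
    nonneg : Nonneg β

open PosRoot public

Πaff-re⁺⇒PosRoot : {β : Qaff n} → β ∈ Πaff-re⁺ → PosRoot β
Πaff-re⁺⇒PosRoot {n} (γ , a , γ∈Π , sgn , refl) with Π-root γ∈Π
... | root p≢q eq = root p≢q (λ k → trans (D-⊕⊛c γ a k) (eq k)) , go γ γ∈Π a sgn
  where
  go : ∀ (γ : Qaff n) → γ ∈ Π → ∀ a → 0ℤ ℤ.< a ⊎ a ≡ 0ℤ × γ ∈ Π⁺ → Nonneg (γ ⊕ a ⊛ c)
  go γ _            a (inj₂ (a≡0 , γ∈Π⁺)) = Nonneg-⊕⊛c γ a λ k →
      0≤+ (proj₁ (Π⁺-bounds γ∈Π⁺ k)) (ℤ.≤-reflexive (sym a≡0))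
  go γ (inj₁ γ∈Π⁺) a (inj₁ 0<a) = Nonneg-⊕⊛c γ a λ k → 0≤+ (proj₁ (Π⁺-bounds γ∈Π⁺ k)) (ℤ.<⇒≤ 0<a)
  go γ (inj₂ γ∈Π⁻) a (inj₁ 0<a) = Nonneg-⊕⊛c γ a λ k → 0≤-1+ (proj₂ (Π⁻-bounds γ∈Π⁻ k)) 0<a

PosRoot⇒Πaff-re⁺ : {β : Qaff n} → PosRoot β → β ∈ Πaff-re⁺
PosRoot⇒Πaff-re⁺ {zero} (root {a = ()} _ _ , _)
PosRoot⇒Πaff-re⁺ {suc n} {β} (r , β≥0) =
  let γ , γ∈Π , β≡ = root-split r in γ , lookup β zero , γ∈Π , sign γ γ∈Π β≡ (≤0-or->0 (lookup β zero)) , β≡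
  where
  sign : ∀ (γ : Qaff (suc n)) → γ ∈ Π → β ≡ γ ⊕ lookup β zero ⊛ c → lookup β zero ℤ.≤ 0ℤ ⊎ 0ℤ ℤ.< lookup β zero →
    0ℤ ℤ.< lookup β zero ⊎ lookup β zero ≡ 0ℤ × γ ∈ Π⁺
  sign _ _            _ (inj₂ 0<a) = inj₁ 0<a
  sign γ (inj₁ γ∈Π⁺) _ (inj₁ a≤0) = inj₂ (ℤ.≤-antisym a≤0 (β≥0 zero) , γ∈Π⁺)
  sign γ (inj₂ γ∈Π⁻) β≡ (inj₁ a≤0) = contradiction (β≥0 , subst Nonpos (sym β≡)
    (Nonpos-⊕⊛c γ (lookup β zero) λ k → +≤0 (proj₁ (Π⁻-bounds γ∈Π⁻ k)) a≤0)) (¬root-0 r)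

-- Lists the ordered pairs of distinct indices: `punchIn a` runs through the indices other than `a`.
pair : ∀ n → Fin (n ℕ.* (n ℕ.∸ 1)) → Fin n × Fin n
pair (suc n) i = let a , j = remQuot {suc n} n i in a , punchIn a j

pair-≢ : ∀ n (i : Fin (n ℕ.* (n ℕ.∸ 1))) → proj₁ (pair n i) ≢ proj₂ (pair n i)
pair-≢ (suc n) i = Fin.punchInᵢ≢i _ _ ∘ sym

pair-injective : ∀ n (i j : Fin (n ℕ.* (n ℕ.∸ 1))) → pair n i ≡ pair n j → i ≡ j
pair-injective (suc n) i j eq = begin
  i                                     ≡⟨ Fin.combine-remQuot {suc n} n i ⟨
  combine (a i) (b i)                   ≡⟨ same (a i) (b i) (a j) (b j) eq ⟩
  combine (a j) (b j)                   ≡⟨ Fin.combine-remQuot {suc n} n j ⟩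
  j                                     ∎
  where
  open ≡-Reasoning
  a : Fin (suc n ℕ.* n) → Fin (suc n)
  a i = proj₁ (remQuot {suc n} n i)
  b : Fin (suc n ℕ.* n) → Fin n
  b i = proj₂ (remQuot {suc n} n i)
  same : ∀ (a : Fin (suc n)) (b : Fin n) (a′ : Fin (suc n)) (b′ : Fin n) →
      (a , punchIn a b) ≡ (a′ , punchIn a′ b′) → combine a b ≡ combine a′ b′
  same a b a′ b′ eq with ,-injectiveˡ eq
  ... | refl = cong (combine a) (Fin.punchIn-injective a b b′ (,-injectiveʳ eq))

pair-surjective : ∀ n (a b : Fin n) → a ≢ b → ∃[ i ] pair n i ≡ (a , b)
pair-surjective (suc n) a b a≢b = combine a (punchOut a≢b) ,
  trans (cong (λ (x , y) → x , punchIn x y) (Fin.remQuot-combine {suc n} a (punchOut a≢b)))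
      (cong (a ,_) (Fin.punchIn-punchOut a≢b))

-- Bilinearity of the form, reflections and the isometries they generate.

module _ {n : ℕ} (3≤n : 3 ≤ n) where

  form-sym : (μ ν : Qaff n) → ⟨ μ , ν ⟩ ≡ ⟨ ν , μ ⟩
  form-sym μ ν = trans (form-D 3≤n μ ν) (trans (sum-cong-≗ λ k → ℤ.*-comm (D μ k) (D ν k)) (sym (form-D 3≤n ν μ)))

  form-cong-D : {μ μ′ : Qaff n} (ν : Qaff n) → (∀ k → D μ k ≡ D μ′ k) → ⟨ μ , ν ⟩ ≡ ⟨ μ′ , ν ⟩
  form-cong-D {μ = μ} {μ′} ν eq =
      trans (form-D 3≤n μ ν) (trans (sum-cong-≗ λ k → cong (ℤ._* D ν k) (eq k)) (sym (form-D 3≤n μ′ ν)))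

  form-⊖⊛ : (μ : Qaff n) (a : ℤ) (β ν : Qaff n) → ⟨ μ ⊖ a ⊛ β , ν ⟩ ≡ ⟨ μ , ν ⟩ ℤ.- a ℤ.* ⟨ β , ν ⟩
  form-⊖⊛ μ a β ν = begin
    ⟨ μ ⊖ a ⊛ β , ν ⟩ ≡⟨ form-D 3≤n (μ ⊖ a ⊛ β) ν ⟩
    sum (λ k → D (μ ⊖ a ⊛ β) k ℤ.* D ν k) ≡⟨ sum-cong-≗ (λ k → cong (ℤ._* D ν k) (D-⊖⊛ μ a β k)) ⟩
    sum (λ k → (D μ k ℤ.- a ℤ.* D β k) ℤ.* D ν k) ≡⟨ sum-linear (D μ) (D β) (D ν) a ⟩
    sum (λ k → D μ k ℤ.* D ν k) ℤ.- a ℤ.* sum (λ k → D β k ℤ.* D ν k)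
      ≡⟨ cong₂ (λ x y → x ℤ.- a ℤ.* y) (form-D 3≤n μ ν) (form-D 3≤n β ν) ⟨
    ⟨ μ , ν ⟩ ℤ.- a ℤ.* ⟨ β , ν ⟩ ∎
    where open ≡-Reasoning

  form-⊖⊛ʳ : (ν μ : Qaff n) (a : ℤ) (β : Qaff n) → ⟨ ν , μ ⊖ a ⊛ β ⟩ ≡ ⟨ ν , μ ⟩ ℤ.- a ℤ.* ⟨ ν , β ⟩
  form-⊖⊛ʳ ν μ a β = trans (form-sym ν (μ ⊖ a ⊛ β))
    (trans (form-⊖⊛ μ a β ν) (cong₂ (λ x y → x ℤ.- a ℤ.* y) (form-sym μ ν) (form-sym β ν)))

  form-⊕ : (μ ν ρ : Qaff n) → ⟨ μ ⊕ ν , ρ ⟩ ≡ ⟨ μ , ρ ⟩ ℤ.+ ⟨ ν , ρ ⟩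
  form-⊕ μ ν ρ = trans (cong ⟨_, ρ ⟩ (⊕-⊖⊛ μ ν)) (trans (form-⊖⊛ μ -1ℤ ν ρ) (collect ⟨ μ , ρ ⟩ ⟨ ν , ρ ⟩))
    where
    collect : ∀ x y → x ℤ.- -1ℤ ℤ.* y ≡ x ℤ.+ y
    collect = solve-∀

  form-D≡0 : (μ ν : Qaff n) → (∀ k → D μ k ≡ 0ℤ) → ⟨ μ , ν ⟩ ≡ 0ℤ
  form-D≡0 μ ν eq = trans (form-D 3≤n μ ν) (sum-0 _ λ k → trans (cong (ℤ._* D ν k) (eq k)) (ℤ.*-zeroˡ (D ν k)))

  form-c : (ν : Qaff n) → ⟨ c , ν ⟩ ≡ 0ℤ
  form-c ν = form-D≡0 c ν D-c

  form-𝟎 : (ν : Qaff n) → ⟨ 𝟎 , ν ⟩ ≡ 0ℤ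
  form-𝟎 ν = form-D≡0 𝟎 ν D-𝟎

  form-neg : (μ ν : Qaff n) → ⟨ map ℤ.-_ μ , ν ⟩ ≡ ℤ.- ⟨ μ , ν ⟩
  form-neg μ ν = trans (cong ⟨_, ν ⟩ (neg-⊖⊛ μ))
      (trans (form-⊖⊛ 𝟎 1ℤ μ ν) (trans (cong (ℤ._- (1ℤ ℤ.* ⟨ μ , ν ⟩)) (form-𝟎 ν)) (minus ⟨ μ , ν ⟩)))
    where
    minus : ∀ y → 0ℤ ℤ.- 1ℤ ℤ.* y ≡ ℤ.- y
    minus = solve-∀

  -- Since `D β` is `ε_a - ε_b`, the scalar product with it picks out two entries of `D μ`. For two
  -- roots the pairing becomes a combination of four deltas.
  form-root : (μ : Qaff n) {β : Qaff n} ((root {a} {b} _ _) : IsRoot β) → ⟨ μ , β ⟩ ≡ D μ a ℤ.- D μ b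
  form-root μ {β} (root {a} {b} _ D-eq) = begin
    ⟨ μ , β ⟩ ≡⟨ form-D 3≤n μ β ⟩
    sum (λ k → D μ k ℤ.* D β k)
      ≡⟨ sum-cong-≗ (λ k → trans (cong (ℤ._*_ (D μ k)) (D-eq k)) (split (D μ k) (δ a k) (δ b k))) ⟩
    sum (λ k → (δ a k ℤ.- 1ℤ ℤ.* δ b k) ℤ.* D μ k) ≡⟨ sum-linear (δ a) (δ b) (D μ) 1ℤ ⟩
    sum (λ k → δ a k ℤ.* D μ k) ℤ.- 1ℤ ℤ.* sum (λ k → δ b k ℤ.* D μ k)
      ≡⟨ cong₂ (λ x y → x ℤ.- 1ℤ ℤ.* y) (pick a) (pick b) ⟩
    D μ a ℤ.- 1ℤ ℤ.* D μ b ≡⟨ cong (ℤ._-_ (D μ a)) (ℤ.*-identityˡ (D μ b)) ⟩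
    D μ a ℤ.- D μ b ∎
    where
    open ≡-Reasoning
    split : ∀ x y z → x ℤ.* (y ℤ.- z) ≡ (y ℤ.- 1ℤ ℤ.* z) ℤ.* x
    split = solve-∀
    pick : ∀ a → sum (λ k → δ a k ℤ.* D μ k) ≡ D μ a
    pick a = trans (sum-cong-≗ λ k → ℤ.*-comm (δ a k) (D μ k)) (sum-δ (D μ) a)

  s-root : (β γ : Qaff n) → IsRoot β → IsRoot γ → IsRoot (s β γ)
  s-root β γ β-root@(root {a} {b} a≢b eq) (root {p} {q} p≢q eq′) = root
    (λ e → p≢q (trans (sym (transpose-inverse b a)) (trans (cong (transpose b a) e) (transpose-inverse b a))))
    λ k → begin
    D (s β γ) k ≡⟨ D-⊖⊛ γ ⟨ γ , β ⟩ β k ⟩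
    D γ k ℤ.- ⟨ γ , β ⟩ ℤ.* D β k
      ≡⟨ cong₂ (λ x y → x ℤ.- ⟨ γ , β ⟩ ℤ.* y) (eq′ k) (eq k) ⟩
    (δ p k ℤ.- δ q k) ℤ.- ⟨ γ , β ⟩ ℤ.* (δ a k ℤ.- δ b k)
      ≡⟨ cong (λ x → (δ p k ℤ.- δ q k) ℤ.- x ℤ.* (δ a k ℤ.- δ b k))
          (trans (form-root γ β-root) (cong₂ ℤ._-_ (eq′ a) (eq′ b))) ⟩
    (δ p k ℤ.- δ q k) ℤ.- ((δ p a ℤ.- δ q a) ℤ.- (δ p b ℤ.- δ q b)) ℤ.* (δ a k ℤ.- δ b k)
      ≡⟨ split (δ p k) (δ q k) (δ p a) (δ q a) (δ p b) (δ q b) (δ a k ℤ.- δ b k) ⟩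
    (δ p k ℤ.- (δ p a ℤ.- δ p b) ℤ.* (δ a k ℤ.- δ b k)) ℤ.- (δ q k ℤ.- (δ q a ℤ.- δ q b) ℤ.* (δ a k ℤ.- δ b k))
      ≡⟨ cong₂ ℤ._-_ (δ-transpose a≢b p k) (δ-transpose a≢b q k) ⟩
    δ (transpose a b p) k ℤ.- δ (transpose a b q) k ∎
    where
    open ≡-Reasoning
    split : ∀ x y z w z′ w′ d → (x ℤ.- y) ℤ.- ((z ℤ.- w) ℤ.- (z′ ℤ.- w′)) ℤ.* d ≡
      (x ℤ.- (z ℤ.- z′) ℤ.* d) ℤ.- (y ℤ.- (w ℤ.- w′) ℤ.* d)
    split = solve-∀

  root-norm : {β : Qaff n} → IsRoot β → ⟨ β , β ⟩ ≡ + 2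
  root-norm {β = β} r = trans (form-root β r) (cong₂ ℤ._-_ (proj₁ (root-D r)) (proj₂ (root-D r)))

  s-linear : (β : Qaff n) (μ : Qaff n) (a : ℤ) (ν : Qaff n) →
    s β (μ ⊖ a ⊛ ν) ≡ s β μ ⊖ a ⊛ s β ν
  s-linear β μ a ν = ext λ k → begin
    lookup (s β (μ ⊖ a ⊛ ν)) k ≡⟨ ⊖⊛-at (μ ⊖ a ⊛ ν) ⟨ μ ⊖ a ⊛ ν , β ⟩ β k ⟩
    lookup (μ ⊖ a ⊛ ν) k ℤ.- ⟨ μ ⊖ a ⊛ ν , β ⟩ ℤ.* lookup β k
      ≡⟨ cong₂ (λ x y → x ℤ.- y ℤ.* lookup β k) (⊖⊛-at μ a ν k) (form-⊖⊛ μ a ν β) ⟩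
    (lookup μ k ℤ.- a ℤ.* lookup ν k) ℤ.- (⟨ μ , β ⟩ ℤ.- a ℤ.* ⟨ ν , β ⟩) ℤ.* lookup β k
      ≡⟨ collect (lookup μ k) a (lookup ν k) ⟨ μ , β ⟩ ⟨ ν , β ⟩ (lookup β k) ⟩
    (lookup μ k ℤ.- ⟨ μ , β ⟩ ℤ.* lookup β k) ℤ.- a ℤ.* (lookup ν k ℤ.- ⟨ ν , β ⟩ ℤ.* lookup β k)
      ≡⟨ cong₂ (λ x y → x ℤ.- a ℤ.* y) (⊖⊛-at μ ⟨ μ , β ⟩ β k) (⊖⊛-at ν ⟨ ν , β ⟩ β k) ⟨
    lookup (s β μ) k ℤ.- a ℤ.* lookup (s β ν) k ≡⟨ ⊖⊛-at (s β μ) a (s β ν) k ⟨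
    lookup (s β μ ⊖ a ⊛ s β ν) k ∎
    where
    open ≡-Reasoning
    collect : ∀ x a y p q b → (x ℤ.- a ℤ.* y) ℤ.- (p ℤ.- a ℤ.* q) ℤ.* b ≡ (x ℤ.- p ℤ.* b) ℤ.- a ℤ.* (y ℤ.- q ℤ.* b)
    collect = solve-∀

  s-isometry : {β : Qaff n} → IsRoot β → ∀ μ ν → ⟨ s β μ , s β ν ⟩ ≡ ⟨ μ , ν ⟩
  s-isometry {β = β} r μ ν = begin
    ⟨ s β μ , s β ν ⟩ ≡⟨ form-⊖⊛ μ ⟨ μ , β ⟩ β (s β ν) ⟩
    ⟨ μ , s β ν ⟩ ℤ.- ⟨ μ , β ⟩ ℤ.* ⟨ β , s β ν ⟩
      ≡⟨ cong₂ (λ x y → x ℤ.- ⟨ μ , β ⟩ ℤ.* y) (form-⊖⊛ʳ μ ν ⟨ ν , β ⟩ β) (form-⊖⊛ʳ β ν ⟨ ν , β ⟩ β) ⟩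
    (⟨ μ , ν ⟩ ℤ.- ⟨ ν , β ⟩ ℤ.* ⟨ μ , β ⟩) ℤ.- ⟨ μ , β ⟩ ℤ.* (⟨ β , ν ⟩ ℤ.- ⟨ ν , β ⟩ ℤ.* ⟨ β , β ⟩)
      ≡⟨ cong₂ (λ x y → (⟨ μ , ν ⟩ ℤ.- ⟨ ν , β ⟩ ℤ.* ⟨ μ , β ⟩) ℤ.- ⟨ μ , β ⟩ ℤ.* (x ℤ.- ⟨ ν , β ⟩ ℤ.* y))
          (form-sym β ν) (root-norm r) ⟩
    (⟨ μ , ν ⟩ ℤ.- ⟨ ν , β ⟩ ℤ.* ⟨ μ , β ⟩) ℤ.- ⟨ μ , β ⟩ ℤ.* (⟨ ν , β ⟩ ℤ.- ⟨ ν , β ⟩ ℤ.* (+ 2))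
      ≡⟨ collect ⟨ μ , ν ⟩ ⟨ μ , β ⟩ ⟨ ν , β ⟩ ⟩
    ⟨ μ , ν ⟩ ∎
    where
    open ≡-Reasoning
    collect : ∀ x p q → (x ℤ.- q ℤ.* p) ℤ.- p ℤ.* (q ℤ.- q ℤ.* (+ 2)) ≡ x
    collect = solve-∀

  s-self : (β : Qaff n) → IsRoot β → s β β ≡ map ℤ.-_ β
  s-self β r = ext λ k → trans (⊖⊛-at β ⟨ β , β ⟩ β k)
    (trans (cong (λ x → lookup β k ℤ.- x ℤ.* lookup β k) (root-norm r))
        (trans (collect (lookup β k)) (sym (neg-at β k))))
    where
    collect : ∀ x → x ℤ.- (+ 2) ℤ.* x ≡ ℤ.- x
    collect = solve-∀

  s-involutive : (β : Qaff n) → IsRoot β → ∀ μ → s β (s β μ) ≡ μ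
  s-involutive β r μ = ext λ k → begin
    lookup (s β (s β μ)) k ≡⟨ ⊖⊛-at (s β μ) ⟨ s β μ , β ⟩ β k ⟩
    lookup (s β μ) k ℤ.- ⟨ s β μ , β ⟩ ℤ.* lookup β k
      ≡⟨ cong₂ (λ x y → x ℤ.- y ℤ.* lookup β k) (⊖⊛-at μ ⟨ μ , β ⟩ β k)
           (trans (form-⊖⊛ μ ⟨ μ , β ⟩ β β) (cong (λ x → ⟨ μ , β ⟩ ℤ.- ⟨ μ , β ⟩ ℤ.* x) (root-norm r))) ⟩
    (lookup μ k ℤ.- ⟨ μ , β ⟩ ℤ.* lookup β k) ℤ.- (⟨ μ , β ⟩ ℤ.- ⟨ μ , β ⟩ ℤ.* (+ 2)) ℤ.* lookup β k
      ≡⟨ collect (lookup μ k) ⟨ μ , β ⟩ (lookup β k) ⟩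
    lookup μ k ∎
    where
    open ≡-Reasoning
    collect : ∀ x p b → (x ℤ.- p ℤ.* b) ℤ.- (p ℤ.- p ℤ.* (+ 2)) ℤ.* b ≡ x
    collect = solve-∀

  s-neg : (β : Qaff n) → s (map ℤ.-_ β) ≗ s β
  s-neg β μ = ext λ k → begin
    lookup (s (map ℤ.-_ β) μ) k ≡⟨ ⊖⊛-at μ ⟨ μ , map ℤ.-_ β ⟩ (map ℤ.-_ β) k ⟩
    lookup μ k ℤ.- ⟨ μ , map ℤ.-_ β ⟩ ℤ.* lookup (map ℤ.-_ β) k
      ≡⟨ cong₂ (λ x y → lookup μ k ℤ.- x ℤ.* y)
          (trans (form-sym μ (map ℤ.-_ β)) (trans (form-neg β μ) (cong ℤ.-_ (form-sym β μ)))) (neg-at β k) ⟩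
    lookup μ k ℤ.- ℤ.- ⟨ μ , β ⟩ ℤ.* ℤ.- lookup β k ≡⟨ collect (lookup μ k) ⟨ μ , β ⟩ (lookup β k) ⟩
    lookup μ k ℤ.- ⟨ μ , β ⟩ ℤ.* lookup β k ≡⟨ ⊖⊛-at μ ⟨ μ , β ⟩ β k ⟨
    lookup (s β μ) k ∎
    where
    open ≡-Reasoning
    collect : ∀ x p b → x ℤ.- ℤ.- p ℤ.* ℤ.- b ≡ x ℤ.- p ℤ.* b
    collect = solve-∀

  -- Collects what the arguments use of a group element. Products of reflections in arbitrary roots
  -- satisfy it directly, with no word in the simple reflections at hand.
  record IsAuto (w : Map n) : Set where
    field
      linear   : ∀ μ a ν → w (μ ⊖ a ⊛ ν) ≡ w μ ⊖ a ⊛ w ν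
      isometry : ∀ μ ν → ⟨ w μ , w ν ⟩ ≡ ⟨ μ , ν ⟩
      root-map : ∀ {β} → IsRoot β → IsRoot (w β)

    map-𝟎 : w 𝟎 ≡ 𝟎
    map-𝟎 = trans (cong w (sym (self-⊖ 𝟎))) (trans (linear 𝟎 1ℤ 𝟎) (self-⊖ (w 𝟎)))
      where
      self-⊖ : ∀ (μ : Qaff n) → μ ⊖ 1ℤ ⊛ μ ≡ 𝟎
      self-⊖ μ = ext λ k → trans (⊖⊛-at μ 1ℤ μ k) (trans (cancel (lookup μ k)) (sym (𝟎-at k)))
        where
        cancel : ∀ x → x ℤ.- 1ℤ ℤ.* x ≡ 0ℤ
        cancel = solve-∀

    map-neg : ∀ μ → w (map ℤ.-_ μ) ≡ map ℤ.-_ (w μ)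
    map-neg μ = begin
      w (map ℤ.-_ μ)   ≡⟨ cong w (neg-⊖⊛ μ) ⟩
      w (𝟎 ⊖ 1ℤ ⊛ μ)   ≡⟨ linear 𝟎 1ℤ μ ⟩
      w 𝟎 ⊖ 1ℤ ⊛ w μ   ≡⟨ cong (_⊖ 1ℤ ⊛ w μ) map-𝟎 ⟩
      𝟎 ⊖ 1ℤ ⊛ w μ     ≡⟨ neg-⊖⊛ (w μ) ⟨
      map ℤ.-_ (w μ)   ∎
      where open ≡-Reasoning

    map-⊕ : ∀ μ ν → w (μ ⊕ ν) ≡ w μ ⊕ w ν
    map-⊕ μ ν = trans (cong w (⊕-⊖⊛ μ ν)) (trans (linear μ -1ℤ ν) (sym (⊕-⊖⊛ (w μ) (w ν))))

    -- The conjugation rule `w s_β w⁻¹ = s_{wβ}`, free of the inverse.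
    map-s : ∀ β μ → w (s β μ) ≡ s (w β) (w μ)
    map-s β μ = trans (linear μ ⟨ μ , β ⟩ β) (cong (λ x → w μ ⊖ x ⊛ w β) (sym (isometry μ β)))

  open IsAuto

  id-auto : IsAuto id
  id-auto = record { linear = λ _ _ _ → refl ; isometry = λ _ _ → refl ; root-map = id }

  ∘-auto : {v w : Map n} → IsAuto v → IsAuto w → IsAuto (v ∘ w)
  ∘-auto {v = v} {w} v-auto w-auto = record
    { linear   = λ μ a ν → trans (cong v (linear w-auto μ a ν)) (linear v-auto (w μ) a (w ν))
    ; isometry = λ μ ν → trans (isometry v-auto (w μ) (w ν)) (isometry w-auto μ ν)
    ; root-map = root-map v-auto ∘ root-map w-auto
    }

  s-auto : {β : Qaff n} → IsRoot β → IsAuto (s β)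
  s-auto {β = β} r = record { linear = s-linear β ; isometry = s-isometry r ; root-map = λ {γ} → s-root β γ r }

  -- Stated at `next j`, so that the negative unit vector sits at `j` and no predecessor function is
  -- required.
  α-D : (j : Fin n) (k : Fin n) → D (α (next j)) k ≡ δ (next j) k ℤ.- δ j k
  α-D j k = cong₂ ℤ._-_ (α-at (next j) k) (trans (α-at (next j) (next k)) (δ-next j k))

  α-root : (i : Fin n) → IsRoot (α i)
  α-root i with next-surjective i
  ... | j , refl = root (next-≢ 3≤n j ∘ sym) (α-D j)

  α-nonneg : (i : Fin n) → Nonneg (α i)
  α-nonneg i k = subst (ℤ._≤_ 0ℤ) (sym (α-at i k)) (0≤δ i k)

  α-pos : (i : Fin n) → PosRoot (α i)
  α-pos i = α-root i , α-nonneg i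

  word-auto : (is : List (Fin n)) → IsAuto (word is)
  word-auto []       = id-auto
  word-auto (i ∷ is) = ∘-auto (s-auto (α-root i)) (word-auto is)

  auto-≗ : {v w : Map n} → v ≗ w → IsAuto w → IsAuto v
  auto-≗ {v = v} {w} eq w-auto = record
    { linear   = λ μ a ν → trans (eq _)
        (trans (linear w-auto μ a ν) (cong₂ (λ x y → x ⊖ a ⊛ y) (sym (eq μ)) (sym (eq ν))))
    ; isometry = λ μ ν → trans (cong₂ ⟨_,_⟩ (eq μ) (eq ν)) (isometry w-auto μ ν)
    ; root-map = λ {β} r → subst IsRoot (sym (eq β)) (root-map w-auto r)
    }

  Waff-auto : {w : Map n} → w ∈ Waff → IsAuto w
  Waff-auto (is , eq) = auto-≗ eq (word-auto is)

  -- Simple reflections on positive roots, and exchange.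

  neg-nonneg : (μ : Qaff n) → Nonpos μ → Nonneg (map ℤ.-_ μ)
  neg-nonneg μ μ≤0 k = subst (ℤ._≤_ 0ℤ) (sym (neg-at μ k)) (ℤ.neg-mono-≤ (μ≤0 k))

  neg-nonpos : (μ : Qaff n) → Nonneg μ → Nonpos (map ℤ.-_ μ)
  neg-nonpos μ μ≥0 k = subst (ℤ._≤ 0ℤ) (sym (neg-at μ k)) (ℤ.neg-mono-≤ (μ≥0 k))

  0≤x≤1 : ∀ {x} → 0ℤ ℤ.≤ x → x ℤ.≤ 1ℤ → x ≡ 0ℤ ⊎ x ≡ 1ℤ
  0≤x≤1 {+ zero}        _ _                 = inj₁ refl
  0≤x≤1 {+ suc zero}    _ _                 = inj₂ refl
  0≤x≤1 {+ suc (suc x)} _ (ℤ.+≤+ (ℕ.s≤s ()))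

  root-D≤1 : {β : Qaff n} → IsRoot β → ∀ k → D β k ℤ.≤ 1ℤ
  root-D≤1 (root {a} {b} _ eq) k = subst (ℤ._≤ 1ℤ) (sym (eq k)) (ℤ.+-mono-≤ (δ≤1 a k) (ℤ.neg-mono-≤ (0≤δ b k)))

  s-α-at : {i k : Fin n} (μ : Qaff n) → k ≢ i → lookup (s (α i) μ) k ≡ lookup μ k
  s-α-at {i = i} {k} μ k≢i = trans (⊖⊛-at μ ⟨ μ , α i ⟩ (α i) k)
    (trans (cong (λ x → lookup μ k ℤ.- ⟨ μ , α i ⟩ ℤ.* x) (trans (α-at i k) (δ-≢ k≢i)))
        (collect (lookup μ k) ⟨ μ , α i ⟩))
    where
    collect : ∀ x p → x ℤ.- p ℤ.* 0ℤ ≡ x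
    collect = solve-∀

  -- A simple reflection changes only the coordinate at `i`, so all others are both nonnegative and
  -- nonpositive. Then `D β i` equals the remaining coordinate, which is therefore at most 1, and it
  -- is not 0 because `β` is a root.
  s-α-nonpos : {β : Qaff n} (i : Fin n) → PosRoot β → Nonpos (s (α i) β) → β ≡ α i
  s-α-nonpos {β = β} i (r , β≥0) sβ≤0 = go (0≤x≤1 (β≥0 i) βᵢ≤1)
    where
    off-i : ∀ {k} → k ≢ i → lookup β k ≡ 0ℤ
    off-i {k} k≢i = ℤ.≤-antisym (subst (ℤ._≤ 0ℤ) (s-α-at β k≢i) (sβ≤0 k)) (β≥0 k)
    βᵢ≤1 : lookup β i ℤ.≤ 1ℤ
    βᵢ≤1 = subst (ℤ._≤ 1ℤ) (trans (cong (ℤ._-_ (lookup β i)) (off-i (next-≢ 3≤n i ∘ sym)))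
        (ℤ.+-identityʳ (lookup β i))) (root-D≤1 r i)
    go : lookup β i ≡ 0ℤ ⊎ lookup β i ≡ 1ℤ → β ≡ α i
    go (inj₁ βᵢ≡0) = contradiction (β≥0 , β≤0) (¬root-0 r)
      where
      β≤0 : Nonpos β
      β≤0 k with k ≟ i
      ... | yes refl = ℤ.≤-reflexive βᵢ≡0
      ... | no k≢i   = ℤ.≤-reflexive (off-i k≢i)
    go (inj₂ βᵢ≡1) = ext at
      where
      at : ∀ k → lookup β k ≡ lookup (α i) k
      at k with k ≟ i
      ... | yes refl = trans βᵢ≡1 (sym (trans (α-at k k) (δ-refl k)))
      ... | no k≢i   = trans (off-i k≢i) (sym (trans (α-at i k) (δ-≢ k≢i)))

  -- The strong exchange condition: the deleted letter is the one at which the image of β turns negative.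
  exchange : (is : List (Fin n)) {β : Qaff n} → PosRoot β → Nonpos (word is β) →
    ∃[ js ] (suc (length js) ≡ length is × word is ∘ s β ≗ word js)
  exchange []       β-pos β≤0 = contradiction (nonneg β-pos , β≤0) (¬root-0 (isRoot β-pos))
  exchange (i ∷ is) {β} β-pos β≤0 = by-sign (root-sign wβ-root)
    where
    wβ-root : IsRoot (word is β)
    wβ-root = root-map (word-auto is) (isRoot β-pos)
    deleted : word is β ≡ α i → ∀ μ → s (α i) (word is (s β μ)) ≡ word is μ
    deleted eq μ = trans (cong (s (α i)) (trans (map-s (word-auto is) β μ) (cong (λ γ → s γ (word is μ)) eq)))
                         (s-involutive (α i) (α-root i) (word is μ))
    by-sign : Nonneg (word is β) ⊎ Nonpos (word is β) →
        ∃[ js ] (suc (length js) ≡ suc (length is) × word (i ∷ is) ∘ s β ≗ word js)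
    by-sign (inj₁ ≥0) = is , refl , deleted (s-α-nonpos {β = word is β} i (wβ-root , ≥0) β≤0)
    by-sign (inj₂ ≤0) = let js , len , eq = exchange is β-pos ≤0 in
      i ∷ js , cong suc len , λ μ → cong (s (α i)) (eq μ)

  -- Lengths and the Bruhat order

  -- The lower-bound half of `HasLength`. It can be carried from `u` to `u ∘ s β` without a word
  -- that attains the bound.
  MinLength : Map n → ℕ → Set
  MinLength u k = ∀ is → u ≗ word is → k ℕ.≤ length is

  MinLength-≗ : {u v : Map n} {k : ℕ} → u ≗ v → MinLength u k → MinLength v k
  MinLength-≗ u≗v min is v≗ = min is λ μ → trans (u≗v μ) (v≗ μ)

  -- A word for `u s_β` sends `β` to `- u β`, which is nonpositive. The exchange condition then
  -- removes a letter and leaves a word for `u`.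
  MinLength-s : {u : Map n} {β : Qaff n} {k : ℕ} → IsAuto u → PosRoot β → Nonneg (u β) →
    MinLength u k → MinLength (u ∘ s β) (suc k)
  MinLength-s {u = u} {β} u-auto β-pos uβ≥0 min is eq =
    let js , len , eq′ = exchange is β-pos ≤0 in
    ℕ.≤-trans (ℕ.s≤s (min js λ μ → trans (cong u (sym (s-involutive β (isRoot β-pos) μ)))
        (trans (eq (s β μ)) (eq′ μ))))
              (ℕ.≤-reflexive len)
    where
    ≤0 : Nonpos (word is β)
    ≤0 = subst Nonpos (trans (sym (map-neg u-auto β)) (trans (cong u (sym (s-self β (isRoot β-pos)))) (eq β)))
        (neg-nonpos (u β) uβ≥0)

  -- Stands in for the inverse of `word is` on roots.
  word-preimage : (is : List (Fin n)) (β : Qaff n) → IsRoot β → ∃[ γ ] (IsRoot γ × word is γ ≡ β)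
  word-preimage []       β r = β , r , refl
  word-preimage (i ∷ is) β r = let γ , γ-root , eq = word-preimage is (s (α i) β) (s-root (α i) β (α-root i) r) in
    γ , γ-root , trans (cong (s (α i)) eq) (s-involutive (α i) (α-root i) β)

  HasLength-≗ : {u v : Map n} {k : ℕ} → u ≗ v → HasLength u k → HasLength v k
  HasLength-≗ u≗v ((is , len , eq) , min) = (is , len , λ μ → trans (sym (u≗v μ)) (eq μ)) , MinLength-≗ u≗v min

  s-word : (i : Fin n) (is : List (Fin n)) (γ : Qaff n) → word is γ ≡ α i →
    word is ∘ s γ ≗ word (i ∷ is)
  s-word i is γ eq μ = trans (map-s (word-auto is) γ μ) (cong (λ β → s β (word is μ)) eq)

  -- With `γ = w⁻¹ α_i` one has `s_i w = w s_γ`. A positive `γ` makes the length go up by one; for a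
  -- negative `γ` the exchange condition, applied to `- γ`, deletes a letter of a minimal word.
  -- Lengths thereby exist by recursion on a word, with no search for a shortest one.
  HasLength-∷ : (i : Fin n) (is : List (Fin n)) {k : ℕ} → HasLength (word is) k →
    ∃[ l ] HasLength (word (i ∷ is)) l
  HasLength-∷ i is {k} ((js , len , eq) , min) =
    let γ , γ-root , eq′ = word-preimage is (α i) (α-root i) in by-sign γ γ-root eq′ (root-sign γ-root)
    where
    shorter : ∀ γ → IsRoot γ → word is γ ≡ α i → Nonpos γ →
        ∃[ ks ] (suc (length ks) ≡ length js × word (i ∷ is) ≗ word ks)
    shorter γ r eq′ γ≤0 = let ks , len′ , eq″ = exchange js -γ-pos ≤0 in ks , len′ , λ μ → begin
      word (i ∷ is) μ                ≡⟨ s-word i is γ eq′ μ ⟨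
      word is (s γ μ)                ≡⟨ cong (word is) (s-neg γ μ) ⟨
      word is (s (map ℤ.-_ γ) μ)     ≡⟨ eq (s (map ℤ.-_ γ) μ) ⟩
      word js (s (map ℤ.-_ γ) μ)     ≡⟨ eq″ μ ⟩
      word ks μ                      ∎
      where
      open ≡-Reasoning
      -γ-pos : PosRoot (map ℤ.-_ γ)
      -γ-pos = neg-root r , neg-nonneg γ γ≤0
      image : word js (map ℤ.-_ γ) ≡ map ℤ.-_ (α i)
      image = begin
        word js (map ℤ.-_ γ) ≡⟨ eq (map ℤ.-_ γ) ⟨
        word is (map ℤ.-_ γ) ≡⟨ map-neg (word-auto is) γ ⟩
        map ℤ.-_ (word is γ) ≡⟨ cong (λ x → map ℤ.-_ x) eq′ ⟩
        map ℤ.-_ (α i)       ∎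
      ≤0 : Nonpos (word js (map ℤ.-_ γ))
      ≤0 = subst Nonpos (sym image) (neg-nonpos (α i) (α-nonneg i))
    cancel : ∀ ls → word (i ∷ is) ≗ word ls → word is ≗ word (i ∷ ls)
    cancel ls eq′ μ = trans (sym (s-involutive (α i) (α-root i) (word is μ))) (cong (s (α i)) (eq′ μ))
    by-sign : ∀ γ → IsRoot γ → word is γ ≡ α i → Nonneg γ ⊎ Nonpos γ → ∃[ l ] HasLength (word (i ∷ is)) l
    by-sign γ r eq′ (inj₁ γ≥0) = suc k , (i ∷ js , cong suc len , λ μ → cong (s (α i)) (eq μ)) ,
      MinLength-≗ {u = word is ∘ s γ} (s-word i is γ eq′)
        (MinLength-s (word-auto is) (r , γ≥0) (subst Nonneg (sym eq′) (α-nonneg i)) min)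
    by-sign γ r eq′ (inj₂ γ≤0) = let ks , len′ , eq″ = shorter γ r eq′ γ≤0 in
      length ks , (ks , refl , eq″) ,
      -- Putting `i` in front of a word for `s_i w` gives a word for `w`, so no word for `s_i w` has
      -- fewer than `k - 1` letters.
      λ ls eq‴ → ℕ.≤-pred (ℕ.≤-trans (ℕ.≤-reflexive (trans len′ len)) (min (i ∷ ls) (cancel ls eq‴)))

  word-length : (is : List (Fin n)) → ∃[ k ] HasLength (word is) k
  word-length []       = 0 , ([] , refl , λ _ → refl) , λ _ _ → ℕ.z≤n
  word-length (i ∷ is) = HasLength-∷ i is (proj₂ (word-length is))

  Waff-length : {w : Map n} → w ∈ Waff → ∃[ k ] HasLength w k
  Waff-length (is , eq) = let k , h = word-length is in k , HasLength-≗ (λ μ → sym (eq μ)) h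

  HasLength-≤ : {u : Map n} {k l : ℕ} → HasLength u k → HasLength u l → k ℕ.≤ l
  HasLength-≤ (_ , min) ((is , len , eq) , _) = ℕ.≤-trans (min is eq) (ℕ.≤-reflexive len)

  ≤ᴮ-length : {u v : Map n} {k l : ℕ} → u ≤ᴮ v → HasLength u k → HasLength v l → k ℕ.≤ l
  ≤ᴮ-length (done u≗v)             hu hv = HasLength-≤ (HasLength-≗ u≗v hu) hv
  ≤ᴮ-length (step _ _ hu′ hu″ lt u≤v) hu hv =
    ℕ.≤-trans (HasLength-≤ hu hu′) (ℕ.≤-trans (ℕ.<⇒≤ lt) (≤ᴮ-length u≤v hu″ hv))

  -- Each `step` strictly raises the length, so none can occur. This gives both that only `id` lies
  -- below `id` and that distinct elements of equal length are incomparable.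
  ≤ᴮ-length-≗ : {u v : Map n} {k l : ℕ} → u ≤ᴮ v → HasLength u k → HasLength v l → l ℕ.≤ k → u ≗ v
  ≤ᴮ-length-≗ (done u≗v) _ _ _ = u≗v
  ≤ᴮ-length-≗ (step _ _ hu′ hu″ lt u≤v) hu hv l≤k = contradiction
    (ℕ.≤-trans lt (ℕ.≤-trans (≤ᴮ-length u≤v hu″ hv) (ℕ.≤-trans l≤k (HasLength-≤ hu hu′)))) (ℕ.<-irrefl refl)

  ≤ᴮ-respˡ : {u u′ v : Map n} → u ≗ u′ → u′ ≤ᴮ v → u ≤ᴮ v
  ≤ᴮ-respˡ eq (done u≗v) = done λ μ → trans (eq μ) (u≗v μ)
  ≤ᴮ-respˡ eq (step β∈ eq′ hu hu′ lt u≤v) =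
    step β∈ (λ μ → trans (eq′ μ) (sym (eq _))) (HasLength-≗ (λ μ → sym (eq μ)) hu) hu′ lt u≤v

  ≤ᴮ-trans : {u v w : Map n} → u ≤ᴮ v → v ≤ᴮ w → u ≤ᴮ w
  ≤ᴮ-trans (done u≗v) v≤w = ≤ᴮ-respˡ u≗v v≤w
  ≤ᴮ-trans (step β∈ eq hu hu′ lt u≤v) v≤w = step β∈ eq hu hu′ lt (≤ᴮ-trans u≤v v≤w)

  -- The criterion by which both filling and merging move up.
  ≤ᴮ-s : {u u′ : Map n} {β : Qaff n} → u ∈ Waff → u′ ∈ Waff → u′ ≗ u ∘ s β →
    PosRoot β → Nonneg (u β) → u ≤ᴮ u′
  ≤ᴮ-s u∈ u′∈ eq β-pos uβ≥0 = let k , hu = Waff-length u∈ ; l , hu′ = Waff-length u′∈ in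
    step (PosRoot⇒Πaff-re⁺ β-pos) eq hu hu′
      (HasLength-min hu′ (MinLength-≗ (λ μ → sym (eq μ)) (MinLength-s (Waff-auto u∈) β-pos uβ≥0 (proj₂ hu))))
      (done λ _ → refl)
    where
    HasLength-min : ∀ {u : Map n} {k l} → HasLength u l → MinLength u k → k ℕ.≤ l
    HasLength-min ((is , len , eq) , _) min = ℕ.≤-trans (min is eq) (ℕ.≤-reflexive len)

  -- Roots with disjoint supports

  Disjoint : Qaff n → Qaff n → Set
  Disjoint μ ν = ∀ k → lookup μ k ≡ 0ℤ ⊎ lookup ν k ≡ 0ℤ

  Bounded : Qaff n → Set
  Bounded μ = ∀ k → lookup μ k ℤ.≤ 1ℤ

  Disjoint-sym : (μ ν : Qaff n) → Disjoint μ ν → Disjoint ν μ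
  Disjoint-sym μ ν d k = Sum.swap (d k)

  0≤* : ∀ {x y} → 0ℤ ℤ.≤ x → 0ℤ ℤ.≤ y → 0ℤ ℤ.≤ x ℤ.* y
  0≤* {x} {y} 0≤x 0≤y = subst (ℤ._≤ x ℤ.* y) (ℤ.*-zeroʳ x) (ℤ.*-monoˡ-≤-nonNeg x {{ℤ.nonNegative 0≤x}} 0≤y)

  gram-≢ : {i j : Fin n} → i ≢ j → gram i j ℤ.≤ 0ℤ
  gram-≢ {i = i} {j} i≢j with i ≟ j
  ... | yes i≡j = contradiction i≡j i≢j
  ... | no _ with j ≟ next i | i ≟ next j
  ...   | yes _ | _     = ℤ.-≤+
  ...   | no _  | yes _ = ℤ.-≤+
  ...   | no _  | no _  = ℤ.≤-refl

  -- Off the diagonal the Gram entries are nonpositive, and the diagonal terms vanish because the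
  -- supports do not meet.
  form-disjoint : (μ ν : Qaff n) → Nonneg μ → Nonneg ν → Disjoint μ ν → ⟨ μ , ν ⟩ ℤ.≤ 0ℤ
  form-disjoint μ ν μ≥0 ν≥0 disj = sum-≤0 _ λ i → sum-≤0 _ λ j → term i j
    where
    pos*neg*pos : ∀ x g y → 0ℤ ℤ.≤ x → g ℤ.≤ 0ℤ → 0ℤ ℤ.≤ y → x ℤ.* g ℤ.* y ℤ.≤ 0ℤ
    pos*neg*pos x g y 0≤x g≤0 0≤y = ℤ.neg-cancel-≤
      (ℤ.≤-trans (0≤* (0≤* 0≤x (ℤ.neg-mono-≤ g≤0)) 0≤y) (ℤ.≤-reflexive (minus x g y)))
      where
      minus : ∀ x g y → x ℤ.* ℤ.- g ℤ.* y ≡ ℤ.- (x ℤ.* g ℤ.* y)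
      minus = solve-∀
    term : ∀ i j → lookup μ i ℤ.* gram i j ℤ.* lookup ν j ℤ.≤ 0ℤ
    term i j = by-cases (i ≟ j)
      where
      zero-factor : lookup μ i ≡ 0ℤ ⊎ lookup ν i ≡ 0ℤ → lookup μ i ℤ.* gram i i ℤ.* lookup ν i ≡ 0ℤ
      zero-factor (inj₁ e) = trans (cong (λ x → x ℤ.* gram i i ℤ.* lookup ν i) e) (left (gram i i) (lookup ν i))
        where
        left : ∀ g y → 0ℤ ℤ.* g ℤ.* y ≡ 0ℤ
        left = solve-∀
      zero-factor (inj₂ e) = trans (cong (ℤ._*_ (lookup μ i ℤ.* gram i i)) e) (ℤ.*-zeroʳ (lookup μ i ℤ.* gram i i))
      by-cases : Dec (i ≡ j) → lookup μ i ℤ.* gram i j ℤ.* lookup ν j ℤ.≤ 0ℤ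
      by-cases (no i≢j)   = pos*neg*pos (lookup μ i) (gram i j) (lookup ν j) (μ≥0 i) (gram-≢ i≢j) (ν≥0 j)
      by-cases (yes refl) = ℤ.≤-reflexive (zero-factor (disj i))

  0≤x-ab : ∀ x a b → 0ℤ ℤ.≤ x → a ℤ.≤ 0ℤ → 0ℤ ℤ.≤ b → 0ℤ ℤ.≤ x ℤ.- a ℤ.* b
  0≤x-ab x a b 0≤x a≤0 0≤b = ℤ.≤-trans (0≤+ 0≤x (0≤* (ℤ.neg-mono-≤ a≤0) 0≤b)) (ℤ.≤-reflexive (minus x a b))
    where
    minus : ∀ x a b → x ℤ.+ ℤ.- a ℤ.* b ≡ x ℤ.- a ℤ.* b
    minus = solve-∀

  Nonneg-⊖⊛ : (μ : Qaff n) (a : ℤ) (ν : Qaff n) → Nonneg μ → a ℤ.≤ 0ℤ → Nonneg ν → Nonneg (μ ⊖ a ⊛ ν)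
  Nonneg-⊖⊛ μ a ν μ≥0 a≤0 ν≥0 k = subst (ℤ._≤_ 0ℤ) (sym (⊖⊛-at μ a ν k))
    (0≤x-ab (lookup μ k) a (lookup ν k) (μ≥0 k) a≤0 (ν≥0 k))

  Nonneg-⊕ : (μ ν : Qaff n) → Nonneg μ → Nonneg ν → Nonneg (μ ⊕ ν)
  Nonneg-⊕ μ ν μ≥0 ν≥0 k = subst (ℤ._≤_ 0ℤ) (sym (⊕-at μ ν k)) (0≤+ (μ≥0 k) (ν≥0 k))

  s-nonneg : (β μ : Qaff n) → Nonneg β → Nonneg μ → Disjoint μ β → Nonneg (s β μ)
  s-nonneg β μ β≥0 μ≥0 disj = Nonneg-⊖⊛ μ ⟨ μ , β ⟩ β μ≥0 (form-disjoint μ β μ≥0 β≥0 disj) β≥0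

  s-disjoint : (β μ ν : Qaff n) → Disjoint μ ν → Disjoint β ν → Disjoint (s β μ) ν
  s-disjoint β μ ν μν βν k = at (μν k) (βν k)
    where
    collect : ∀ p → 0ℤ ℤ.- p ℤ.* 0ℤ ≡ 0ℤ
    collect = solve-∀
    at : lookup μ k ≡ 0ℤ ⊎ lookup ν k ≡ 0ℤ → lookup β k ≡ 0ℤ ⊎ lookup ν k ≡ 0ℤ →
        lookup (s β μ) k ≡ 0ℤ ⊎ lookup ν k ≡ 0ℤ
    at (inj₂ e) _         = inj₂ e
    at (inj₁ _) (inj₂ e)  = inj₂ e
    at (inj₁ e) (inj₁ e′) = inj₁ (trans (⊖⊛-at μ ⟨ μ , β ⟩ β k)
        (trans (cong₂ (λ x y → x ℤ.- ⟨ μ , β ⟩ ℤ.* y) e e′) (collect ⟨ μ , β ⟩)))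

  disjoint-sum≤1 : ∀ {x y} → 0ℤ ℤ.≤ x → 0ℤ ℤ.≤ y → x ℤ.+ y ℤ.≤ 1ℤ → x ≡ 0ℤ ⊎ y ≡ 0ℤ
  disjoint-sum≤1 {+ zero}  {_}       _ _ _ = inj₁ refl
  disjoint-sum≤1 {+ suc _} {+ zero}  _ _ _ = inj₂ refl
  disjoint-sum≤1 {+ suc x} {+ suc y} _ _ (ℤ.+≤+ (ℕ.s≤s le)) = contradiction (ℕ.≤-trans (ℕ.m≤n+m (suc y) x) le) λ ()

  -- The bound by `c` turns into disjointness here: two nonnegative integers with sum at most 1 are
  -- not both positive.
  Disjoint-⊕ : (μ ν : Qaff n) → Nonneg μ → Nonneg ν → Bounded (μ ⊕ ν) → Disjoint μ ν
  Disjoint-⊕ μ ν μ≥0 ν≥0 le k = disjoint-sum≤1 (μ≥0 k) (ν≥0 k) (subst (ℤ._≤ 1ℤ) (⊕-at μ ν k) (le k))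

  Boundedˡ : (μ ν : Qaff n) → Nonneg ν → Bounded (μ ⊕ ν) → Bounded μ
  Boundedˡ μ ν ν≥0 le k = ℤ.≤-trans
      (subst (ℤ._≤ lookup μ k ℤ.+ lookup ν k) (ℤ.+-identityʳ (lookup μ k)) (ℤ.+-monoʳ-≤ (lookup μ k) (ν≥0 k)))
    (subst (ℤ._≤ 1ℤ) (⊕-at μ ν k) (le k))

  Boundedʳ : (μ ν : Qaff n) → Nonneg μ → Bounded (μ ⊕ ν) → Bounded ν
  Boundedʳ μ ν μ≥0 le = Boundedˡ ν μ μ≥0 (subst Bounded (⊕-comm μ ν) le)

  -- Heights, and reduced words for reflections in roots below c.

  ht : Qaff n → ℤ
  ht μ = sum (lookup μ)

  ht-⊕ : (μ ν : Qaff n) → ht (μ ⊕ ν) ≡ ht μ ℤ.+ ht ν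
  ht-⊕ μ ν = trans (sum-cong-≗ (⊕-at μ ν)) (∑-distrib-+ (lookup μ) (lookup ν))

  ht-α : (i : Fin n) → ht (α i) ≡ 1ℤ
  ht-α i = trans (sum-cong-≗ λ k → trans (α-at i k) (sym (ℤ.*-identityˡ (δ i k)))) (sum-δ (λ _ → 1ℤ) i)

  ht-nonneg : (μ : Qaff n) → Nonneg μ → 0ℤ ℤ.≤ ht μ
  ht-nonneg μ μ≥0 = sum-nonneg (lookup μ) μ≥0
    where
    sum-nonneg : ∀ {n} (f : Fin n → ℤ) → (∀ k → 0ℤ ℤ.≤ f k) → 0ℤ ℤ.≤ sum f
    sum-nonneg {zero}  f le = ℤ.≤-refl
    sum-nonneg {suc n} f le = 0≤+ (le zero) (sum-nonneg (f ∘ suc) (le ∘ suc))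

  -- The index is the length of the reflection, i.e. 2 ht β - 1.
  data Arc : Qaff n → ℕ → Set where
    simple : ∀ i → Arc (α i) 1
    grow   : ∀ {β γ ℓ} i → Arc β ℓ → lookup β i ≡ 0ℤ → ⟨ β , α i ⟩ ≡ -1ℤ → γ ≡ β ⊕ α i → Arc γ (2 ℕ.+ ℓ)

  s-⊕ : (β μ : Qaff n) → ⟨ μ , β ⟩ ≡ -1ℤ → s β μ ≡ μ ⊕ β
  s-⊕ β μ e = trans (cong (λ x → μ ⊖ x ⊛ β) e) (sym (⊕-⊖⊛ μ β))

  Arc-root : {β : Qaff n} {ℓ : ℕ} → Arc β ℓ → IsRoot β
  Arc-root (simple i)                = α-root i
  Arc-root (grow {β} i arc _ e refl) = subst IsRoot (s-⊕ (α i) β e) (s-root (α i) β (α-root i) (Arc-root arc))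

  s-conj : (β γ : Qaff n) → IsRoot β → ∀ μ → s (s β γ) μ ≡ s β (s γ (s β μ))
  s-conj β γ r μ = trans (cong (s (s β γ)) (sym (s-involutive β r μ))) (sym (map-s (s-auto {β = β} r) γ (s β μ)))

  s-grow : (β γ : Qaff n) (i : Fin n) → ⟨ β , α i ⟩ ≡ -1ℤ → γ ≡ β ⊕ α i → ∀ μ → s γ μ ≡ s (α i) (s β (s (α i) μ))
  s-grow β γ i e eq μ = trans (cong (λ x → s x μ) (trans eq (sym (s-⊕ (α i) β e)))) (s-conj (α i) β (α-root i) μ)

  word-++ : (is js : List (Fin n)) → word (is ++ js) ≗ word is ∘ word js
  word-++ []       js μ = refl
  word-++ (i ∷ is) js μ = cong (s (α i)) (word-++ is js μ)

  Arc-word : {β : Qaff n} {ℓ : ℕ} → Arc β ℓ → ∃[ is ] (length is ≡ ℓ × s β ≗ word is)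
  Arc-word (simple i) = i ∷ [] , refl , λ _ → refl
  Arc-word (grow {β} {γ} i arc _ e eq) = let is , len , eq′ = Arc-word arc in
    i ∷ is ++ i ∷ [] ,
    cong suc (trans (length-++ is) (trans (ℕ.+-comm (length is) 1) (cong suc len))) ,
    λ μ → trans (s-grow β γ i e eq μ) (cong (s (α i)) (trans (eq′ (s (α i) μ)) (sym (word-++ is (i ∷ []) μ))))

  Arc-ht : {β : Qaff n} {ℓ : ℕ} → Arc β ℓ → ht β ℤ.+ ht β ≡ + suc ℓ
  Arc-ht (simple i) = cong₂ ℤ._+_ (ht-α i) (ht-α i)
  Arc-ht (grow {β} {γ} {ℓ} i arc _ _ refl) =
      trans (cong (λ x → x ℤ.+ x) (trans (ht-⊕ β (α i)) (cong (ℤ._+_ (ht β)) (ht-α i))))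
    (trans (collect (ht β)) (cong (ℤ._+_ (+ 2)) (Arc-ht arc)))
    where
    collect : ∀ x → (x ℤ.+ 1ℤ) ℤ.+ (x ℤ.+ 1ℤ) ≡ (+ 2) ℤ.+ (x ℤ.+ x)
    collect = solve-∀

  α-disjoint : (i : Fin n) (μ : Qaff n) → lookup μ i ≡ 0ℤ → Disjoint (α i) μ
  α-disjoint i μ e k with k ≟ i
  ... | yes refl = inj₂ e
  ... | no k≢i   = inj₁ (trans (α-at i k) (δ-≢ k≢i))

  grow-support : (β : Qaff n) (i j : Fin n) → lookup β i ≡ 0ℤ → lookup β j ≢ 0ℤ → lookup (β ⊕ α i) j ≢ 0ℤ
  grow-support β i j βᵢ≡0 βⱼ≢0 e = βⱼ≢0 (trans (sym (ℤ.+-identityʳ (lookup β j)))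
    (trans (cong (ℤ._+_ (lookup β j)) (sym (trans (α-at i j) (δ-≢ {a = i} {j} λ { refl → βⱼ≢0 βᵢ≡0 }))))
        (trans (sym (⊕-at β (α i) j)) e)))

  grow-support-i : (β : Qaff n) (i : Fin n) → lookup β i ≡ 0ℤ → lookup (β ⊕ α i) i ≢ 0ℤ
  grow-support-i β i βᵢ≡0 e = contradiction
      (trans (sym e) (trans (⊕-at β (α i) i) (cong₂ ℤ._+_ βᵢ≡0 (trans (α-at i i) (δ-refl i))))) λ ()

  -- An arc builds `β` by adding simple roots from its support, and `u` is additive.
  Arc-image : {β : Qaff n} {ℓ : ℕ} {u : Map n} → Arc β ℓ → IsAuto u →
    (∀ j → lookup β j ≢ 0ℤ → Nonneg (u (α j))) → Nonneg (u β)
  Arc-image (simple i) _ u≥0 = u≥0 i λ e → contradiction (trans (sym e) (trans (α-at i i) (δ-refl i))) λ ()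
  Arc-image {u = u} (grow {β} i arc βᵢ≡0 _ refl) u-auto u≥0 = subst Nonneg (sym (map-⊕ u-auto β (α i)))
    (Nonneg-⊕ (u β) (u (α i)) (Arc-image arc u-auto λ j βⱼ≢0 → u≥0 j (grow-support β i j βᵢ≡0 βⱼ≢0))
        (u≥0 i (grow-support-i β i βᵢ≡0)))

  s-grow-∘ : (u : Map n) (β γ : Qaff n) (i : Fin n) → ⟨ β , α i ⟩ ≡ -1ℤ → γ ≡ β ⊕ α i →
    ((u ∘ s (α i)) ∘ s β) ∘ s (α i) ≗ u ∘ s γ
  s-grow-∘ u β γ i e eq μ = cong u {y = s γ μ} (sym (s-grow β γ i e eq μ))

  -- With `γ = β + α_i` the map `u s_γ` is `u s_i s_β s_i`, and the bound grows along these factors.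
  -- After the first `s_i` the images of the simple roots in the support of `β` stay nonnegative,
  -- since `⟨ α_j , α_i ⟩ ≤ 0`. At the last factor `s_i s_β α_i = β`, so the image to be checked is
  -- `u β`. Positivity is assumed on the support of the arc alone, which lets a second arc follow a
  -- disjoint first one.
  Arc-MinLength : {β : Qaff n} {ℓ k : ℕ} {u : Map n} → Arc β ℓ → IsAuto u →
    (∀ j → lookup β j ≢ 0ℤ → Nonneg (u (α j))) → MinLength u k → MinLength (u ∘ s β) (ℓ ℕ.+ k)
  Arc-MinLength {u = u} (simple i) u-auto u≥0 min =
    MinLength-s u-auto (α-pos i) (Arc-image {u = u} (simple i) u-auto u≥0) min
  Arc-MinLength {k = k} {u} (grow {β} {γ} {ℓ} i arc βᵢ≡0 e eq) u-auto u≥0 min =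
    MinLength-≗ {u = ((u ∘ s (α i)) ∘ s β) ∘ s (α i)} {v = u ∘ s γ} regroup final
    where
    γ-support : ∀ j → lookup β j ≢ 0ℤ → lookup γ j ≢ 0ℤ
    γ-support j βⱼ≢0 = subst (λ x → lookup x j ≢ 0ℤ) (sym eq) (grow-support β i j βᵢ≡0 βⱼ≢0)
    γ-support-i : lookup γ i ≢ 0ℤ
    γ-support-i = subst (λ x → lookup x i ≢ 0ℤ) (sym eq) (grow-support-i β i βᵢ≡0)
    u₁-auto : IsAuto (u ∘ s (α i))
    u₁-auto = ∘-auto u-auto (s-auto {β = α i} (α-root i))
    u₁≥0 : ∀ j → lookup β j ≢ 0ℤ → Nonneg (u (s (α i) (α j)))
    u₁≥0 j βⱼ≢0 = subst Nonneg (sym (linear u-auto (α j) ⟨ α j , α i ⟩ (α i)))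
      (Nonneg-⊖⊛ (u (α j)) ⟨ α j , α i ⟩ (u (α i)) (u≥0 j (γ-support j βⱼ≢0))
        (form-disjoint (α j) (α i) (α-nonneg j) (α-nonneg i)
          (α-disjoint j (α i) (trans (α-at i j) (δ-≢ {a = i} {j} λ { refl → βⱼ≢0 βᵢ≡0 }))))
        (u≥0 i γ-support-i))
    last≡ : u (s (α i) (s β (α i))) ≡ u β
    last≡ = begin
      u (s (α i) (s β (α i)))     ≡⟨ cong (u ∘ s (α i)) (s-⊕ β (α i) (trans (form-sym (α i) β) e)) ⟩
      u (s (α i) (α i ⊕ β))       ≡⟨ cong (u ∘ s (α i)) (trans (⊕-comm (α i) β) (sym (s-⊕ (α i) β e))) ⟩
      u (s (α i) (s (α i) β))     ≡⟨ cong u (s-involutive (α i) (α-root i) β) ⟩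
      u β                         ∎
      where open ≡-Reasoning
    last≥0 : Nonneg (u (s (α i) (s β (α i))))
    last≥0 = subst Nonneg (sym last≡) (Arc-image arc u-auto λ j βⱼ≢0 → u≥0 j (γ-support j βⱼ≢0))
    regroup : ((u ∘ s (α i)) ∘ s β) ∘ s (α i) ≗ u ∘ s γ
    regroup = s-grow-∘ u β γ i e eq
    first : MinLength (u ∘ s (α i)) (suc k)
    first = MinLength-s {u = u} {β = α i} u-auto (α-pos i) (u≥0 i γ-support-i) min
    middle : MinLength ((u ∘ s (α i)) ∘ s β) (ℓ ℕ.+ suc k)
    middle = Arc-MinLength {u = u ∘ s (α i)} arc u₁-auto u₁≥0 first
    middle-auto : IsAuto ((u ∘ s (α i)) ∘ s β)
    middle-auto = ∘-auto u₁-auto (s-auto {β = β} (Arc-root arc))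
    final : MinLength (((u ∘ s (α i)) ∘ s β) ∘ s (α i)) (2 ℕ.+ ℓ ℕ.+ k)
    final = MinLength-s {u = (u ∘ s (α i)) ∘ s β} {β = α i} middle-auto (α-pos i) last≥0
      (subst (MinLength ((u ∘ s (α i)) ∘ s β)) (ℕ.+-suc ℓ k) middle)

  0≤1 : 0ℤ ℤ.≤ 1ℤ
  0≤1 = ℤ.+≤+ ℕ.z≤n

  ⊕-assoc : (μ ν ρ : Qaff n) → (μ ⊕ ν) ⊕ ρ ≡ μ ⊕ (ν ⊕ ρ)
  ⊕-assoc μ ν ρ = ext λ k → begin
    lookup ((μ ⊕ ν) ⊕ ρ) k
      ≡⟨ trans (⊕-at (μ ⊕ ν) ρ k) (cong (ℤ._+ lookup ρ k) (⊕-at μ ν k)) ⟩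
    (lookup μ k ℤ.+ lookup ν k) ℤ.+ lookup ρ k     ≡⟨ ℤ.+-assoc (lookup μ k) (lookup ν k) (lookup ρ k) ⟩
    lookup μ k ℤ.+ (lookup ν k ℤ.+ lookup ρ k)
      ≡⟨ trans (⊕-at μ (ν ⊕ ρ) k) (cong (ℤ._+_ (lookup μ k)) (⊕-at ν ρ k)) ⟨
    lookup (μ ⊕ (ν ⊕ ρ)) k                         ∎
    where open ≡-Reasoning

  ⊕-leftComm : (μ ν ρ : Qaff n) → μ ⊕ (ν ⊕ ρ) ≡ ν ⊕ (μ ⊕ ρ)
  ⊕-leftComm μ ν ρ = trans (sym (⊕-assoc μ ν ρ)) (trans (cong (_⊕ ρ) (⊕-comm μ ν)) (⊕-assoc ν μ ρ))

  root-support : {β : Qaff n} → PosRoot β → ∃[ k ] lookup β k ≢ 0ℤ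
  root-support {β} (r@(root {a} _ _) , β≥0) = a , λ e → ℤ.<⇒≱ (ℤ.-<+ {0} {0})
    (ℤ.≤-trans (β≥0 (next a)) (ℤ.≤-reflexive (minus-one (lookup β a) (lookup β (next a)) e (proj₁ (root-D r)))))
    where
    minus-one : ∀ x y → x ≡ 0ℤ → x ℤ.- y ≡ 1ℤ → y ≡ -1ℤ
    minus-one x y refl e = trans (sym (ℤ.neg-involutive y)) (cong ℤ.-_ (trans (sym (ℤ.+-identityˡ (ℤ.- y))) e))

  α-support : (i k : Fin n) → D (α i) k ≡ δ i k ℤ.- δ i (next k)
  α-support i k = cong₂ ℤ._-_ (α-at i k) (α-at i (next k))

  difference-1 : ∀ {x y} → 0ℤ ℤ.≤ x → x ℤ.≤ 1ℤ → 0ℤ ℤ.≤ y → x ℤ.- y ≡ 1ℤ → x ≡ 1ℤ × y ≡ 0ℤ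
  difference-1 {+ 0} {+ zero} _ _ _ ()
  difference-1 {+ 0} {+ suc y} _ _ _ ()
  difference-1 {+ 1} {+ zero} _ _ _ _ = refl , refl
  difference-1 {+ 1} {+ suc zero} _ _ _ ()
  difference-1 {+ 1} {+ suc (suc y)} _ _ _ ()
  difference-1 {+ suc (suc x)} _ (ℤ.+≤+ (ℕ.s≤s ()))

  Shrinkable : Qaff n → Fin n → Set
  Shrinkable β i = ∃[ γ ] (PosRoot γ × Bounded γ × lookup γ i ≡ 0ℤ × ⟨ γ , α i ⟩ ≡ -1ℤ × β ≡ γ ⊕ α i)

  -- The support runs cyclically from `next b` to `a`, and its last index `a` is removed. If
  -- `next b = a`, then `β` and `α a` have the same differences and both vanish at `next a`.
  -- Otherwise `⟨ β , α a ⟩ = 1`, so that `s (α a) β` is `β - α_a`.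
  shrink : {β : Qaff n} → PosRoot β → Bounded β → ∃[ i ] (β ≡ α i ⊎ Shrinkable β i)
  shrink {β} (r@(root {a} {b} a≢b eq) , β≥0) β≤1 = a , by-cases (next b ≟ a)
    where
    open ≡-Reasoning
    ends : lookup β a ≡ 1ℤ × lookup β (next a) ≡ 0ℤ
    ends = difference-1 (β≥0 a) (β≤1 a) (β≥0 (next a)) (proj₁ (root-D r))
    by-cases : Dec (next b ≡ a) → β ≡ α a ⊎ Shrinkable β a
    by-cases (yes refl) = inj₁ (ext λ k → ℤ.i-j≡0⇒i≡j (lookup β k) (lookup (α a) k) (begin
      lookup β k ℤ.- lookup (α a) k         ≡⟨ cong (ℤ._-_ (lookup β k)) (ℤ.*-identityˡ (lookup (α a) k)) ⟨
      lookup β k ℤ.- 1ℤ ℤ.* lookup (α a) k  ≡⟨ ⊖⊛-at β 1ℤ (α a) k ⟨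
      lookup (β ⊖ 1ℤ ⊛ α a) k               ≡⟨ D≡0⇒constant (β ⊖ 1ℤ ⊛ α a) D≡0 k (next a) ⟩
      lookup (β ⊖ 1ℤ ⊛ α a) (next a)        ≡⟨ ⊖⊛-at β 1ℤ (α a) (next a) ⟩
      lookup β (next a) ℤ.- 1ℤ ℤ.* lookup (α a) (next a)
        ≡⟨ cong₂ (λ x y → x ℤ.- 1ℤ ℤ.* y) (proj₂ ends) (trans (α-at a (next a)) (δ-≢ (next-≢ 3≤n a ∘ sym))) ⟩
      0ℤ                                    ∎))
      where
      D≡0 : ∀ k → D (β ⊖ 1ℤ ⊛ α a) k ≡ 0ℤ
      D≡0 k = trans (D-⊖⊛ β 1ℤ (α a) k)
          (trans (cong₂ (λ x y → x ℤ.- 1ℤ ℤ.* y) (eq k) (α-D b k)) (cancel (δ a k ℤ.- δ b k)))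
        where
        cancel : ∀ x → x ℤ.- 1ℤ ℤ.* x ≡ 0ℤ
        cancel = solve-∀
    by-cases (no nb≢a) = inj₂ (γ , (s-root (α a) β (α-root a) r , γ≥0) , γ≤1 , γₐ≡0 , γ-α , β≡)
      where
      γ : Qaff n
      γ = s (α a) β
      form-1 : ⟨ β , α a ⟩ ≡ 1ℤ
      form-1 = begin
        ⟨ β , α a ⟩                 ≡⟨ form-sym β (α a) ⟩
        ⟨ α a , β ⟩                 ≡⟨ form-root (α a) r ⟩
        D (α a) a ℤ.- D (α a) b
          ≡⟨ cong₂ ℤ._-_ (trans (α-support a a) (cong₂ ℤ._-_ (δ-refl a) (δ-≢ (next-≢ 3≤n a ∘ sym))))
                                                   (trans (α-support a b) (cong₂ ℤ._-_ (δ-≢ (a≢b ∘ sym))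
                                                       (δ-≢ nb≢a))) ⟩
        1ℤ                          ∎
      γ-at : ∀ k → lookup γ k ≡ lookup β k ℤ.- 1ℤ ℤ.* δ a k
      γ-at k = trans (⊖⊛-at β ⟨ β , α a ⟩ (α a) k) (cong₂ (λ x y → lookup β k ℤ.- x ℤ.* y) form-1 (α-at a k))
      γₐ≡0 : lookup γ a ≡ 0ℤ
      γₐ≡0 = trans (γ-at a) (cong₂ (λ x y → x ℤ.- 1ℤ ℤ.* y) (proj₁ ends) (δ-refl a))
      γ≥0 : Nonneg γ
      γ≥0 k with k ≟ a
      ... | yes refl = ℤ.≤-reflexive (sym γₐ≡0)
      ... | no k≢a   = subst (ℤ._≤_ 0ℤ) (sym (s-α-at β k≢a)) (β≥0 k)
      γ≤1 : Bounded γ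
      γ≤1 k with k ≟ a
      ... | yes refl = ℤ.≤-trans (ℤ.≤-reflexive γₐ≡0) 0≤1
      ... | no k≢a   = subst (ℤ._≤ 1ℤ) (sym (s-α-at β k≢a)) (β≤1 k)
      γ-α : ⟨ γ , α a ⟩ ≡ -1ℤ
      γ-α = trans (form-⊖⊛ β ⟨ β , α a ⟩ (α a) (α a)) (cong₂ (λ x y → x ℤ.- x ℤ.* y) form-1 (root-norm (α-root a)))
      β≡ : β ≡ γ ⊕ α a
      β≡ = ext λ k → sym (trans (⊕-at γ (α a) k)
          (trans (cong₂ ℤ._+_ (γ-at k) (α-at a k)) (collect (lookup β k) (δ a k))))
        where
        collect : ∀ x y → (x ℤ.- 1ℤ ℤ.* y) ℤ.+ y ≡ x
        collect = solve-∀

  -- `N` is fuel that bounds the height, which each removal lowers by one.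
  toArc : (N : ℕ) {β : Qaff n} → PosRoot β → Bounded β → ht β ℤ.≤ + N → ∃[ ℓ ] Arc β ℓ
  toArc N {β} β-pos β≤1 le = let i , cases = shrink β-pos β≤1 in by-cases N le cases
    where
    by-cases : ∀ N → ht β ℤ.≤ + N → ∀ {i} → β ≡ α i ⊎ Shrinkable β i → ∃[ ℓ ] Arc β ℓ
    by-cases N _ {i} (inj₁ refl) = 1 , simple i
    by-cases N le {i} (inj₂ (γ , γ-pos , γ≤1 , γᵢ≡0 , e , eq)) = recurse N (subst (ℤ._≤ + N) ht-β le)
      where
      ht-β : ht β ≡ ht γ ℤ.+ 1ℤ
      ht-β = trans (cong ht eq) (trans (ht-⊕ γ (α i)) (cong (ℤ._+_ (ht γ)) (ht-α i)))
      pred-≤ : ∀ {x N} → x ℤ.+ 1ℤ ℤ.≤ + suc N → x ℤ.≤ + N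
      pred-≤ {x} {N} le = subst₂ ℤ._≤_ (cancel x) refl (ℤ.+-monoˡ-≤ -1ℤ le)
        where
        cancel : ∀ x → (x ℤ.+ 1ℤ) ℤ.+ -1ℤ ≡ x
        cancel = solve-∀
      recurse : ∀ N → ht γ ℤ.+ 1ℤ ℤ.≤ + N → ∃[ ℓ ] Arc β ℓ
      recurse zero    le = contradiction (ℤ.≤-trans (ℤ.+-monoˡ-≤ 1ℤ (ht-nonneg γ (nonneg γ-pos))) le)
          λ { (ℤ.+≤+ ()) }
      recurse (suc N) le = let ℓ , arc = toArc N γ-pos γ≤1 (pred-≤ le) in 2 ℕ.+ ℓ , grow i arc γᵢ≡0 e eq

  PosRoot-arc : {β : Qaff n} → PosRoot β → Bounded β → ∃[ ℓ ] Arc β ℓ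
  PosRoot-arc {β} β-pos β≤1 = toArc ℤ.∣ ht β ∣ β-pos β≤1
      (ℤ.≤-reflexive (sym (ℤ.0≤i⇒+∣i∣≡i (ht-nonneg β (nonneg β-pos)))))

  -- Products of reflections in roots with disjoint supports.

  prod : List (Qaff n) → Map n
  prod []       = id
  prod (β ∷ βs) = s β ∘ prod βs

  total : List (Qaff n) → Qaff n
  total []       = 𝟎
  total (β ∷ βs) = β ⊕ total βs

  total-nonneg : ∀ {βs} → All PosRoot βs → Nonneg (total βs)
  total-nonneg []                     k = ℤ.≤-reflexive (sym (𝟎-at k))
  total-nonneg {β ∷ βs} (β-pos ∷ pos) k = Nonneg-⊕ β (total βs) (nonneg β-pos) (total-nonneg pos) k

  apart : (μ : Qaff n) (βs : List (Qaff n)) → Nonneg μ → All PosRoot βs → Bounded (μ ⊕ total βs) →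
      All (Disjoint μ) βs
  apart μ []       _   _            _  = []
  apart μ (β ∷ βs) μ≥0 (β-pos ∷ pos) le =
    Disjoint-⊕ μ β μ≥0 (nonneg β-pos)
        (Boundedˡ (μ ⊕ β) (total βs) (total-nonneg pos) (subst Bounded (sym (⊕-assoc μ β (total βs))) le)) ∷
    apart μ βs μ≥0 pos (Boundedʳ β (μ ⊕ total βs) (nonneg β-pos) (subst Bounded (⊕-leftComm μ β (total βs)) le))

  pairs : (βs : List (Qaff n)) → All PosRoot βs → Bounded (total βs) → AllPairs Disjoint βs
  pairs []       _             _  = []
  pairs (β ∷ βs) (β-pos ∷ pos) le = apart β βs (nonneg β-pos) pos le ∷ pairs βs pos
      (Boundedʳ β (total βs) (nonneg β-pos) le)

  prod-auto : ∀ {βs} → All PosRoot βs → IsAuto (prod βs)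
  prod-auto []            = id-auto
  prod-auto (β-pos ∷ pos) = ∘-auto (s-auto (isRoot β-pos)) (prod-auto pos)

  s-Waff : {β : Qaff n} → PosRoot β → Bounded β → s β ∈ Waff
  s-Waff β-pos β≤1 = let _ , arc = PosRoot-arc β-pos β≤1 ; is , _ , eq = Arc-word arc in is , eq

  ∘-Waff : {v w : Map n} → v ∈ Waff → w ∈ Waff → v ∘ w ∈ Waff
  ∘-Waff {v} {w} (is , eq) (js , eq′) = is ++ js , λ μ →
      trans (eq (w μ)) (trans (cong (word is) (eq′ μ)) (sym (word-++ is js μ)))

  id-Waff : id ∈ Waff {n}
  id-Waff = [] , λ _ → refl

  prod-Waff : (βs : List (Qaff n)) → All PosRoot βs → Bounded (total βs) → prod βs ∈ Waff
  prod-Waff []       _             _  = id-Waff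
  prod-Waff (β ∷ βs) (β-pos ∷ pos) le =
    ∘-Waff (s-Waff β-pos (Boundedˡ β (total βs) (total-nonneg pos) le))
        (prod-Waff βs pos (Boundedʳ β (total βs) (nonneg β-pos) le))

  -- Pulling `μ` back through one factor `s_β` keeps it positive, as it is disjoint from `β`, and
  -- keeps it disjoint from the later roots, as `β` is too. The result turns a factor `s_μ` in front
  -- of the product into a factor `s_ν` behind it, where `≤ᴮ-s` applies.
  prod-preimage : (βs : List (Qaff n)) (μ : Qaff n) → All PosRoot βs → AllPairs Disjoint βs →
      All (Disjoint μ) βs → PosRoot μ →
    ∃[ ν ] (PosRoot ν × prod βs ν ≡ μ)
  prod-preimage []       μ _ _ _ μ-pos = μ , μ-pos , refl
  prod-preimage (β ∷ βs) μ (β-pos ∷ pos) (β-disj ∷ disj) (μβ ∷ μ-disj) μ-pos =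
    let ν , ν-pos , eq = prod-preimage βs (s β μ) pos disj
                           (All.zipWith (λ {γ} (d , d′) → s-disjoint β μ γ d d′) (μ-disj , β-disj))
                           (s-root β μ (isRoot β-pos) (isRoot μ-pos) , s-nonneg β μ (nonneg β-pos)
                               (nonneg μ-pos) μβ)
    in ν , ν-pos , trans (cong (s β) eq) (s-involutive β (isRoot β-pos) μ)

  -- Pairings of disjoint roots, and merging.

  -1≤x≤0 : ∀ {x} → -1ℤ ℤ.≤ x → x ℤ.≤ 0ℤ → x ≡ 0ℤ ⊎ x ≡ -1ℤ
  -1≤x≤0 {+ zero}           _ _ = inj₁ refl
  -1≤x≤0 {+ suc _}          _ (ℤ.+≤+ ())
  -1≤x≤0 {ℤ.-[1+ zero ]}    _ _ = inj₂ refl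
  -1≤x≤0 {ℤ.-[1+ suc _ ]}   (ℤ.-≤- ()) _

  -- The scalar product of `ε_p - ε_q` and `ε_a - ε_b` is below -1 only for `p = b` and `q = a`,
  -- when the roots are opposite modulo `c`. The upper bound 0 is `form-disjoint`.
  disjoint-roots : {β γ : Qaff n} → PosRoot β → PosRoot γ → Disjoint β γ →
    (⟨ β , γ ⟩ ≡ 0ℤ ⊎ ⟨ β , γ ⟩ ≡ -1ℤ) ⊎ (∀ k → D (β ⊕ γ) k ≡ 0ℤ)
  disjoint-roots {β} {γ} (root {p} {q} _ eq , β≥0) (r@(root {a} {b} _ eq′) , γ≥0) disj = by-cases (p ≟ b) (q ≟ a)
    where
    form≡ : ⟨ β , γ ⟩ ≡ (δ p a ℤ.- δ q a) ℤ.- (δ p b ℤ.- δ q b)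
    form≡ = trans (form-root β r) (cong₂ ℤ._-_ (eq a) (eq b))
    form≤0 : ⟨ β , γ ⟩ ℤ.≤ 0ℤ
    form≤0 = form-disjoint β γ β≥0 γ≥0 disj
    -1≤ : ∀ x y z → 0ℤ ℤ.≤ x → y ℤ.≤ 1ℤ → 0ℤ ℤ.≤ z → -1ℤ ℤ.≤ (x ℤ.- y) ℤ.+ z
    -1≤ x y z 0≤x y≤1 0≤z = ℤ.+-mono-≤ (ℤ.+-mono-≤ 0≤x (ℤ.neg-mono-≤ y≤1)) 0≤z
    by-cases : Dec (p ≡ b) → Dec (q ≡ a) → (⟨ β , γ ⟩ ≡ 0ℤ ⊎ ⟨ β , γ ⟩ ≡ -1ℤ) ⊎ (∀ k → D (β ⊕ γ) k ≡ 0ℤ)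
    by-cases (no p≢b) _ = inj₁ (-1≤x≤0
        (subst (ℤ._≤_ -1ℤ) (sym eq″) (-1≤ (δ p a) (δ q a) (δ q b) (0≤δ p a) (δ≤1 q a) (0≤δ q b))) form≤0)
      where
      drop : ∀ x y z → (x ℤ.- y) ℤ.- (0ℤ ℤ.- z) ≡ (x ℤ.- y) ℤ.+ z
      drop = solve-∀
      eq″ : ⟨ β , γ ⟩ ≡ (δ p a ℤ.- δ q a) ℤ.+ δ q b
      eq″ = trans form≡ (trans (cong (λ x → (δ p a ℤ.- δ q a) ℤ.- (x ℤ.- δ q b)) (δ-≢ (p≢b ∘ sym)))
          (drop (δ p a) (δ q a) (δ q b)))
    by-cases (yes _) (no q≢a) = inj₁
        (-1≤x≤0 (subst (ℤ._≤_ -1ℤ) (sym eq″) (-1≤ (δ p a) (δ p b) (δ q b) (0≤δ p a) (δ≤1 p b) (0≤δ q b))) form≤0)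
      where
      drop : ∀ x y z → (x ℤ.- 0ℤ) ℤ.- (y ℤ.- z) ≡ (x ℤ.- y) ℤ.+ z
      drop = solve-∀
      eq″ : ⟨ β , γ ⟩ ≡ (δ p a ℤ.- δ p b) ℤ.+ δ q b
      eq″ = trans form≡ (trans (cong (λ x → (δ p a ℤ.- x) ℤ.- (δ p b ℤ.- δ q b)) (δ-≢ (q≢a ∘ sym)))
          (drop (δ p a) (δ p b) (δ q b)))
    by-cases (yes refl) (yes refl) = inj₂ λ k →
        trans (D-⊕ β γ k) (trans (cong₂ ℤ._+_ (eq k) (eq′ k)) (cancel (δ p k) (δ q k)))
      where
      cancel : ∀ x y → (x ℤ.- y) ℤ.+ (y ℤ.- x) ≡ 0ℤ
      cancel = solve-∀

  Uncovered : Qaff n → Qaff n → Set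
  Uncovered β γ = ∃[ k ] (lookup β k ≡ 0ℤ × lookup γ k ≡ 0ℤ)

  -- In the exceptional case `β + γ` has constant coordinates, and an index outside both supports
  -- makes the constant zero. Two positive roots cannot cancel.
  uncovered-roots : {β γ : Qaff n} → PosRoot β → PosRoot γ → Disjoint β γ → Uncovered β γ →
      ⟨ β , γ ⟩ ≡ 0ℤ ⊎ ⟨ β , γ ⟩ ≡ -1ℤ
  uncovered-roots {β} {γ} β-pos γ-pos disj (k , βₖ≡0 , γₖ≡0) = by-cases (disjoint-roots β-pos γ-pos disj)
    where
    by-cases : (⟨ β , γ ⟩ ≡ 0ℤ ⊎ ⟨ β , γ ⟩ ≡ -1ℤ) ⊎ (∀ k → D (β ⊕ γ) k ≡ 0ℤ) → ⟨ β , γ ⟩ ≡ 0ℤ ⊎ ⟨ β , γ ⟩ ≡ -1ℤ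
    by-cases (inj₁ e) = e
    by-cases (inj₂ D≡0) = contradiction (nonneg γ-pos , γ≤0) (¬root-0 (isRoot γ-pos))
      where
      γ≤0 : Nonpos γ
      γ≤0 l = ℤ.≤-trans (subst (ℤ._≤ lookup β l ℤ.+ lookup γ l) (ℤ.+-identityˡ (lookup γ l))
          (ℤ.+-monoˡ-≤ (lookup γ l) (nonneg β-pos l)))
        (ℤ.≤-reflexive (trans (sym (⊕-at β γ l))
            (trans (D≡0⇒constant (β ⊕ γ) D≡0 l k) (trans (⊕-at β γ k) (cong₂ ℤ._+_ βₖ≡0 γₖ≡0)))))

  s-comm : (β γ : Qaff n) → IsRoot β → ⟨ γ , β ⟩ ≡ 0ℤ → ∀ μ → s β (s γ μ) ≡ s γ (s β μ)
  s-comm β γ r e μ = trans (map-s (s-auto r) γ μ) (cong (λ x → s x (s β μ)) fixed)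
    where
    drop : ∀ x y → x ℤ.- 0ℤ ℤ.* y ≡ x
    drop = solve-∀
    fixed : s β γ ≡ γ
    fixed = ext λ k → trans (⊖⊛-at γ ⟨ γ , β ⟩ β k)
        (trans (cong (λ x → lookup γ k ℤ.- x ℤ.* lookup β k) e) (drop (lookup γ k) (lookup β k)))

  -- `P` is the product of the factors already passed over. The fields from `ν` on are the data with
  -- which `≤ᴮ-s` places `P ∘ prod (β ∷ βs)` below `P ∘ prod γs`, and `shorter` says that `γs` has
  -- one root fewer than `β ∷ βs`.
  record Merged (P : Map n) (β : Qaff n) (βs : List (Qaff n)) : Set where
    field
      γs       : List (Qaff n)
      shorter  : length γs ≡ length βs
      pos      : All PosRoot γs
      same     : total γs ≡ total (β ∷ βs)
      ν        : Qaff n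
      ν-pos    : PosRoot ν
      image≥0  : Nonneg (P (prod (β ∷ βs) ν))
      merge-eq : ∀ μ → P (prod (β ∷ βs) (s ν μ)) ≡ P (prod γs μ)

  -- s_β commutes to the right past the roots orthogonal to β, up to the first γ with ⟨γ,β⟩ = -1;
  -- there s_β s_γ is replaced by s_{β+γ} = s_β s_γ s_β.
  merge : (P : Map n) (β : Qaff n) (βs : List (Qaff n)) → IsAuto P → All PosRoot (β ∷ βs) →
      Bounded (total (β ∷ βs)) →
    All (Nonneg ∘ P) βs → All (λ γ → Uncovered γ β) βs → ⟨ total βs , β ⟩ ≢ 0ℤ → Merged P β βs
  merge P β [] _ _ _ _ _ ≢0 = contradiction (form-𝟎 β) ≢0
  merge P β (γ ∷ βs) P-auto (β-pos ∷ γ-pos ∷ pos) le (Pγ≥0 ∷ P≥0) (unc ∷ uncs) ≢0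
    with pairs (β ∷ γ ∷ βs) (β-pos ∷ γ-pos ∷ pos) le
  ... | (βγ ∷ β-disj) ∷ (γ-disj ∷ disj) = by-cases (uncovered-roots γ-pos β-pos (Disjoint-sym β γ βγ) unc)
    where
    open ≡-Reasoning
    by-cases : ⟨ γ , β ⟩ ≡ 0ℤ ⊎ ⟨ γ , β ⟩ ≡ -1ℤ → Merged P β (γ ∷ βs)
    by-cases (inj₁ e) = record
      { γs       = γ ∷ rest.γs
      ; shorter  = cong suc rest.shorter
      ; pos      = γ-pos ∷ rest.pos
      ; same     = trans (cong (γ ⊕_) rest.same) (⊕-leftComm γ β (total βs))
      ; ν        = rest.ν
      ; ν-pos    = rest.ν-pos
      ; image≥0  = subst Nonneg (cong P (sym (s-comm β γ (isRoot β-pos) e (prod βs rest.ν)))) rest.image≥0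
      ; merge-eq = λ μ → trans (cong P (s-comm β γ (isRoot β-pos) e (prod βs (s rest.ν μ)))) (rest.merge-eq μ)
      }
      where
      -- Absorbing `s_γ` into the prefix preserves positivity: `P (s_γ ρ)` is `P ρ` minus a
      -- nonpositive multiple of `P γ`.
      Ps≥0 : ∀ {ρ} → Nonneg (P ρ) × Disjoint γ ρ × PosRoot ρ → Nonneg (P (s γ ρ))
      Ps≥0 {ρ} (Pρ≥0 , γρ , ρ-pos) = subst Nonneg (sym (IsAuto.linear P-auto ρ ⟨ ρ , γ ⟩ γ))
        (Nonneg-⊖⊛ (P ρ) ⟨ ρ , γ ⟩ (P γ) Pρ≥0
            (form-disjoint ρ γ (nonneg ρ-pos) (nonneg γ-pos) (Disjoint-sym γ ρ γρ)) Pγ≥0)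
      module rest = Merged (merge (P ∘ s γ) β βs (∘-auto P-auto (s-auto (isRoot γ-pos))) (β-pos ∷ pos)
        (Boundedʳ γ (β ⊕ total βs) (nonneg γ-pos) (subst Bounded (⊕-leftComm β γ (total βs)) le))
        (All.map Ps≥0 (All.zip (P≥0 , All.zip (γ-disj , pos))))
        uncs
        (λ e′ → ≢0 (trans (form-⊕ γ (total βs) β) (cong₂ ℤ._+_ e e′))))
    -- Choosing `ν` as the preimage of `β` under `prod βs` makes a final `s_ν` appear as an `s_β`
    -- directly after `s_γ`. The root to be tested is `s_β s_γ β = s_β (β + γ) = γ`, on which `P` is
    -- nonnegative by hypothesis.
    by-cases (inj₂ e) = let ν , ν-pos , eq = prod-preimage βs β pos disj β-disj β-pos in record
      { γs       = s β γ ∷ βs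
      ; shorter  = refl
      ; pos      = (s-root β γ (isRoot β-pos) (isRoot γ-pos) , s-nonneg β γ (nonneg β-pos) (nonneg γ-pos)
            (Disjoint-sym β γ βγ)) ∷ pos
      ; same     = trans (cong (_⊕ total βs) (s-⊕ β γ e))
            (trans (⊕-assoc γ β (total βs)) (⊕-leftComm γ β (total βs)))
      ; ν        = ν
      ; ν-pos    = ν-pos
      ; image≥0  = subst Nonneg (cong P (sym (image ν eq))) Pγ≥0
      ; merge-eq = λ μ → cong P (begin
          s β (s γ (prod βs (s ν μ)))         ≡⟨ cong (s β ∘ s γ) (map-s (prod-auto pos) ν μ) ⟩
          s β (s γ (s (prod βs ν) (prod βs μ))) ≡⟨ cong (λ x → s β (s γ (s x (prod βs μ)))) eq ⟩
          s β (s γ (s β (prod βs μ)))         ≡⟨ s-conj β γ (isRoot β-pos) (prod βs μ) ⟨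
          s (s β γ) (prod βs μ)               ∎)
      }
      where
      image : ∀ ν → prod βs ν ≡ β → s β (s γ (prod βs ν)) ≡ γ
      image ν eq = begin
        s β (s γ (prod βs ν))   ≡⟨ cong (s β ∘ s γ) eq ⟩
        s β (s γ β)             ≡⟨ cong (s β) (s-⊕ γ β (trans (form-sym β γ) e)) ⟩
        s β (β ⊕ γ)             ≡⟨ cong (s β) (trans (⊕-comm β γ) (sym (s-⊕ β γ e))) ⟩
        s β (s β γ)             ≡⟨ s-involutive β (isRoot β-pos) γ ⟩
        γ                       ∎

  record Split : Set where
    field
      β γ   : Qaff n
      β-pos : PosRoot β
      γ-pos : PosRoot γ
      sum≡c : β ⊕ γ ≡ c

  uncovered : {β γ ρ : Qaff n} → PosRoot ρ → Disjoint β ρ → Disjoint γ ρ → Uncovered β γ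
  uncovered {β} {γ} {ρ} ρ-pos βρ γρ =
    let k , ρₖ≢0 = root-support ρ-pos in k , zero-at k ρₖ≢0 (βρ k) , zero-at k ρₖ≢0 (γρ k)
    where
    zero-at : ∀ {x : ℤ} k → lookup ρ k ≢ 0ℤ → x ≡ 0ℤ ⊎ lookup ρ k ≡ 0ℤ → x ≡ 0ℤ
    zero-at k ≢0 (inj₁ e) = e
    zero-at k ≢0 (inj₂ e) = contradiction e ≢0

  c-bounded : {μ : Qaff n} → μ ≡ c → Bounded μ
  c-bounded eq k = ℤ.≤-reflexive (trans (cong (λ x → lookup x k) eq) (c-at k))

  -- The recursion runs on the list returned by `merge`, hence the explicit length `N`. A list of
  -- fewer than two roots cannot have total `c`, which is neither zero nor a real root.
  merge-all : (N : ℕ) (βs : List (Qaff n)) → length βs ≡ N → All PosRoot βs → total βs ≡ c →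
    ∃[ σ ] (prod βs ≤ᴮ s (Split.β σ) ∘ s (Split.γ σ))
  merge-all _ [] _ _ eq = contradiction (trans (sym (trans (cong (λ x → lookup x k₀) eq) (c-at k₀))) (𝟎-at k₀))
      λ ()
    where
    index : ∀ {n} → 3 ℕ.≤ n → Fin n
    index (ℕ.s≤s _) = zero
    k₀ : Fin n
    k₀ = index 3≤n
  merge-all _ (β ∷ []) _ (β-pos ∷ []) eq = contradiction
    (λ k → trans (cong (λ x → D x k) (trans (sym (⊕-identityʳ β)) eq)) (D-c k)) (¬root-D≡0 (isRoot β-pos))
  merge-all _ (β ∷ γ ∷ []) _ (β-pos ∷ γ-pos ∷ []) eq =
    record { β = β ; γ = γ ; β-pos = β-pos ; γ-pos = γ-pos ; sum≡c =
        trans (cong (β ⊕_) (sym (⊕-identityʳ γ))) eq } , done λ _ → refl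
  merge-all (suc N) (β ∷ βs@(γ ∷ ρ ∷ ρs)) len (β-pos ∷ pos@(γ-pos ∷ ρ-pos ∷ ρs-pos)) eq
    with pairs (β ∷ βs) (β-pos ∷ pos) (c-bounded eq)
  ... | (βγ ∷ βρ ∷ βρs) ∷ ((γρ ∷ γρs) ∷ _) = σ , ≤ᴮ-trans
    (≤ᴮ-s (prod-Waff (β ∷ βs) (β-pos ∷ pos) (c-bounded eq)) (prod-Waff merged.γs merged.pos (c-bounded total≡c))
      (λ μ → sym (merged.merge-eq μ)) merged.ν-pos merged.image≥0)
    rest
    where
    -- An index missed by `β` and `γ` is found in the support of `ρ`; for every later partner of
    -- `β`, including `ρ`, one is found in the support of `γ`.
    uncs : All (λ γ → Uncovered γ β) βs
    uncs = uncovered {γ} {β} ρ-pos γρ βρ ∷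
      All.map (λ {τ} (γτ , βτ) → uncovered {τ} {β} γ-pos (Disjoint-sym γ τ γτ) βγ)
          (All.zip ((γρ ∷ γρs) , (βρ ∷ βρs)))
    ≢0 : ⟨ total βs , β ⟩ ≢ 0ℤ
    ≢0 e = contradiction (trans (sym (trans (form-⊕ β (total βs) β) (cong₂ ℤ._+_ (root-norm (isRoot β-pos)) e)))
                                (trans (cong (λ x → ⟨ x , β ⟩) eq) (form-c β))) λ ()
    module merged = Merged (merge id β βs id-auto (β-pos ∷ pos) (c-bounded eq) (All.map nonneg pos) uncs ≢0)
    total≡c : total merged.γs ≡ c
    total≡c = trans merged.same eq
    recursive : ∃[ σ ] (prod merged.γs ≤ᴮ s (Split.β σ) ∘ s (Split.γ σ))
    recursive = merge-all N merged.γs (trans merged.shorter (ℕ.suc-injective len)) merged.pos total≡c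
    σ = proj₁ recursive
    rest = proj₂ recursive

  -- Completing a product to total degree c.

  record Filled (ks : List (Fin n)) (βs : List (Qaff n)) : Set where
    field
      γs      : List (Qaff n)
      pos     : All PosRoot γs
      bounded : Bounded (total γs)
      full    : All (λ k → lookup (total γs) k ≡ 1ℤ) ks
      above   : prod βs ≤ᴮ prod γs

  -- An index with coefficient 0 receives its simple root in front. The other coefficients do not
  -- change, so indices treated before stay full. Running through `allFin n` makes the total equal
  -- to `c`.
  fill : (ks : List (Fin n)) (βs : List (Qaff n)) → All PosRoot βs → Bounded (total βs) → Filled ks βs
  fill [] βs pos le = record { γs = βs ; pos = pos ; bounded = le ; full = [] ; above = done λ _ → refl }
  fill (k ∷ ks) βs βs-pos βs≤1 = by-cases (0≤x≤1 (total-nonneg pos k) (bounded k))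
    where
    open Filled (fill ks βs βs-pos βs≤1)
    by-cases : lookup (total γs) k ≡ 0ℤ ⊎ lookup (total γs) k ≡ 1ℤ → Filled (k ∷ ks) βs
    by-cases (inj₂ e) = record { γs = γs ; pos = pos ; bounded = bounded ; full = e ∷ full ; above = above }
    by-cases (inj₁ e) = record
      { γs      = α k ∷ γs
      ; pos     = α-pos k ∷ pos
      ; bounded = bounded′
      ; full    = trans (total-at k) (cong₂ ℤ._+_ (δ-refl k) e) ∷ All.map
            (λ {l} e′ → trans (total-at l) (cong₂ ℤ._+_ (δ-≢ (l≢k e′)) e′)) full
      ; above   =
          let ν , ν-pos , eq = prod-preimage γs (α k) pos (pairs γs pos bounded)
                                 (apart (α k) γs (α-nonneg k) pos bounded′) (α-pos k) in
          ≤ᴮ-trans above (≤ᴮ-s (prod-Waff γs pos bounded) (prod-Waff (α k ∷ γs) (α-pos k ∷ pos) bounded′)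
            (λ μ → sym (trans (map-s (prod-auto pos) ν μ) (cong (λ x → s x (prod γs μ)) eq)))
            ν-pos (subst Nonneg (sym eq) (α-nonneg k)))
      }
      where
      total-at : ∀ l → lookup (total (α k ∷ γs)) l ≡ δ k l ℤ.+ lookup (total γs) l
      total-at l = trans (⊕-at (α k) (total γs) l) (cong (ℤ._+ lookup (total γs) l) (α-at k l))
      l≢k : ∀ {l} → lookup (total γs) l ≡ 1ℤ → l ≢ k
      l≢k e′ refl = contradiction (trans (sym e) e′) λ ()
      bounded′ : Bounded (total (α k ∷ γs))
      bounded′ l = by-index (l ≟ k)
        where
        by-index : Dec (l ≡ k) → lookup (total (α k ∷ γs)) l ℤ.≤ 1ℤ
        by-index (yes refl) = ℤ.≤-reflexive (trans (total-at k) (cong₂ ℤ._+_ (δ-refl k) e))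
        by-index (no l≢k)   = subst (ℤ._≤ 1ℤ)
            (sym (trans (total-at l) (trans (cong (ℤ._+ lookup (total γs) l) (δ-≢ l≢k))
                (ℤ.+-identityˡ (lookup (total γs) l))))) (bounded l)

  below-split : (βs : List (Qaff n)) → All PosRoot βs → Bounded (total βs) →
      ∃[ σ ] (prod βs ≤ᴮ s (Split.β σ) ∘ s (Split.γ σ))
  below-split βs βs-pos βs≤1 =
    let σ , le = merge-all (length γs) γs refl pos
                   (ext λ k → trans (All.lookup full (∈-allFin k)) (sym (c-at k))) in
    σ , ≤ᴮ-trans above le
    where
    open Filled (fill (allFin n) βs βs-pos βs≤1)

  -- Translations as products of two reflections.

  t-cong : (γ γ′ : Qaff n) → (∀ k → D γ k ≡ D γ′ k) → t γ ≗ t γ′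
  t-cong γ γ′ eq μ = cong (λ x → μ ⊖ x ⊛ c) (form-cong-D {μ = γ} {γ′} μ eq)

  -- Because `β + γ = c`, pairing with `β` is the negative of pairing with `γ`. With `q = ⟨ μ , γ ⟩`
  -- the second reflection therefore has coefficient `- q + 2 q = q`, and the two subtract
  -- `q γ + q β = q c`.
  s-s-t : (σ : Split) → s (Split.β σ) ∘ s (Split.γ σ) ≗ t (Split.γ σ)
  s-s-t σ μ = ext λ k → begin
    lookup (s β (s γ μ)) k ≡⟨ ⊖⊛-at (s γ μ) ⟨ s γ μ , β ⟩ β k ⟩
    lookup (s γ μ) k ℤ.- ⟨ s γ μ , β ⟩ ℤ.* lookup β k
      ≡⟨ cong₂ (λ x y → x ℤ.- y ℤ.* lookup β k) (⊖⊛-at μ q γ k) pairing ⟩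
    (lookup μ k ℤ.- q ℤ.* lookup γ k) ℤ.- q ℤ.* lookup β k ≡⟨ collect (lookup μ k) q (lookup β k) (lookup γ k) ⟩
    lookup μ k ℤ.- q ℤ.* (lookup β k ℤ.+ lookup γ k)
      ≡⟨ cong₂ (λ x y → lookup μ k ℤ.- x ℤ.* y) (form-sym μ γ)
          (trans (sym (⊕-at β γ k)) (cong (λ x → lookup x k) sum≡c)) ⟩
    lookup μ k ℤ.- ⟨ γ , μ ⟩ ℤ.* lookup c k ≡⟨ ⊖⊛-at μ ⟨ γ , μ ⟩ c k ⟨
    lookup (t γ μ) k ∎
    where
    open ≡-Reasoning
    open Split σ
    q : ℤ
    q = ⟨ μ , γ ⟩
    opposite : ∀ {x y} → x ℤ.+ y ≡ 0ℤ → x ≡ ℤ.- y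
    opposite {x} {y} e = trans (add-sub x y) (trans (cong (ℤ._- y) e) (ℤ.+-identityˡ (ℤ.- y)))
      where
      add-sub : ∀ x y → x ≡ (x ℤ.+ y) ℤ.- y
      add-sub = solve-∀
    form-β : ∀ ρ → ⟨ β , ρ ⟩ ≡ ℤ.- ⟨ γ , ρ ⟩
    form-β ρ = opposite (trans (sym (form-⊕ β γ ρ)) (trans (cong (λ x → ⟨ x , ρ ⟩) sum≡c) (form-c ρ)))
    pairing : ⟨ s γ μ , β ⟩ ≡ q
    pairing = begin
      ⟨ s γ μ , β ⟩                           ≡⟨ form-⊖⊛ μ q γ β ⟩
      ⟨ μ , β ⟩ ℤ.- q ℤ.* ⟨ γ , β ⟩           ≡⟨ cong₂ (λ x y → x ℤ.- q ℤ.* y)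
                                                    (trans (form-sym μ β) (trans (form-β μ)
                                                        (cong ℤ.-_ (form-sym γ μ))))
                                                    (trans (form-sym γ β) (trans (form-β γ)
                                                        (cong ℤ.-_ (root-norm (isRoot γ-pos))))) ⟩
      ℤ.- q ℤ.- q ℤ.* ℤ.- (+ 2)               ≡⟨ twice q ⟩
      q                                       ∎
      where
      twice : ∀ x → ℤ.- x ℤ.- x ℤ.* ℤ.- (+ 2) ≡ x
      twice = solve-∀
    collect : ∀ x q b g → (x ℤ.- q ℤ.* g) ℤ.- q ℤ.* b ≡ x ℤ.- q ℤ.* (b ℤ.+ g)
    collect = solve-∀

  -- Reachable elements and translations

  Chain⇒prod : {u v : Map n} {e : Qaff n} → Chain u v e →
      ∃[ βs ] (All PosRoot βs × total βs ≡ e × ∀ μ → v μ ≡ u (prod βs μ))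
  Chain⇒prod ([] eq) = [] , [] , refl , λ μ → sym (eq μ)
  Chain⇒prod (_∷_ {β} (_ , _ , β∈ , eq) ch) = let βs , pos , sum , eq′ = Chain⇒prod ch in
    β ∷ βs , Πaff-re⁺⇒PosRoot β∈ ∷ pos , cong (β ⊕_) sum , λ μ → trans (eq′ μ) (eq (prod βs μ))

  Chain-respʳ : {u v v′ : Map n} {e : Qaff n} → v ≗ v′ → Chain u v e → Chain u v′ e
  Chain-respʳ eq ([] eq′)  = [] λ μ → trans (eq′ μ) (eq μ)
  Chain-respʳ eq (e ∷ ch)  = e ∷ Chain-respʳ eq ch

  𝐜-at : (k : Fin n) → lookup (toQaff 𝐜) k ≡ 1ℤ
  𝐜-at k = trans (lookup-map k +_ 𝐜) (cong +_ (lookup-replicate k 1))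

  Reachable-respʳ : {v v′ : Map n} → v ≗ v′ → v ∈ Reachable 𝐜 id → v′ ∈ Reachable 𝐜 id
  Reachable-respʳ eq ((is , eq′) , u , u∈ , u≤ , e , ch , e≤) =
    (is , λ μ → trans (sym (eq μ)) (eq′ μ)) , u , u∈ , u≤ , e , Chain-respʳ eq ch , e≤

  id-length : HasLength {n} id 0
  id-length = ([] , refl , λ _ → refl) , λ _ _ → ℕ.z≤n

  Reachable⇒≤ᴮt : {v : Map n} → v ∈ Reachable 𝐜 id → ∃[ γ ] (γ ∈ Π × v ≤ᴮ t γ)
  Reachable⇒≤ᴮt {v} (_ , u , u∈ , u≤id , e , ch , e≤) =
    let βs , pos , sum , eq = Chain⇒prod ch
        σ , le = below-split βs pos λ k → subst₂ ℤ._≤_ (cong (λ x → lookup x k) (sym sum)) (𝐜-at k)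
            (Pointwise.lookup e≤ k)
    in finish σ (≤ᴮ-respˡ (λ μ → trans (eq μ) (u≗id (prod βs μ))) le) (isRoot (Split.γ-pos σ))
    where
    -- The starting point lies below `id`, of length 0, so it is `id`.
    u≗id : u ≗ id
    u≗id = ≤ᴮ-length-≗ u≤id (proj₂ (Waff-length u∈)) id-length ℕ.z≤n
    finish : ∀ σ → v ≤ᴮ s (Split.β σ) ∘ s (Split.γ σ) → IsRoot (Split.γ σ) → ∃[ γ ] (γ ∈ Π × v ≤ᴮ t γ)
    -- `Split.γ σ` may differ from a finite root by a multiple of `c`. The finite root with the same
    -- differences has the same translation.
    finish σ le (root {a} {b} a≢b eq) = let γ , γ∈Π , eq′ = Π-D a b a≢b in
      γ , γ∈Π , ≤ᴮ-trans le (done λ μ →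
          trans (s-s-t σ μ) (t-cong (Split.γ σ) γ (λ k → trans (eq k) (sym (eq′ k))) μ))

  -- γ ∈ Π⁻ is moved to the positive root γ + c, which has the same translation.
  Π-split : {γ : Qaff n} → γ ∈ Π → ∃[ σ ] (∀ k → D (Split.γ σ) k ≡ D γ k)
  Π-split {γ} γ∈Π = by-sign γ∈Π
    where
    r : IsRoot γ
    r = Π-root γ∈Π
    complement : (β : Qaff n) → PosRoot β → Bounded β → Split
    complement β (β-root@(root a≢b eq) , β≥0) β≤1 = record
      { β     = c ⊖ 1ℤ ⊛ β
      ; γ     = β
      ; β-pos = root (a≢b ∘ sym) (λ k →
            trans (D-⊖⊛ c 1ℤ β k) (trans (cong₂ (λ x y → x ℤ.- 1ℤ ℤ.* y) (D-c k) (eq k)) (swap (δ _ k) (δ _ k)))) ,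
                λ k → subst (ℤ._≤_ 0ℤ) (sym (c-β-at k)) (ℤ.i≤j⇒0≤j-i (β≤1 k))
      ; γ-pos = β-root , β≥0
      ; sum≡c = ext λ k → trans (⊕-at (c ⊖ 1ℤ ⊛ β) β k)
            (trans (cong (ℤ._+ lookup β k) (c-β-at k)) (trans (restore (lookup β k)) (sym (c-at k))))
      }
      where
      swap : ∀ x y → 0ℤ ℤ.- 1ℤ ℤ.* (x ℤ.- y) ≡ y ℤ.- x
      swap = solve-∀
      restore : ∀ x → (1ℤ ℤ.- x) ℤ.+ x ≡ 1ℤ
      restore = solve-∀
      c-β-at : ∀ k → lookup (c ⊖ 1ℤ ⊛ β) k ≡ 1ℤ ℤ.- lookup β k
      c-β-at k = trans (⊖⊛-at c 1ℤ β k) (cong₂ ℤ._-_ (c-at k) (ℤ.*-identityˡ (lookup β k)))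
    by-sign : γ ∈ Π → ∃[ σ ] (∀ k → D (Split.γ σ) k ≡ D γ k)
    by-sign (inj₁ γ∈Π⁺) = complement γ (r , (λ k → proj₁ (Π⁺-bounds γ∈Π⁺ k))) (λ k → proj₂ (Π⁺-bounds γ∈Π⁺ k)) ,
        λ _ → refl
    by-sign (inj₂ γ∈Π⁻) = complement (γ ⊕ 1ℤ ⊛ c)
        (shifted r , Nonneg-⊕⊛c γ 1ℤ (λ k → 0≤-1+ (proj₂ (Π⁻-bounds γ∈Π⁻ k)) (ℤ.+<+ (ℕ.s≤s ℕ.z≤n))))
      (λ k → subst (ℤ._≤ 1ℤ) (sym (⊕⊛c-at γ 1ℤ k)) (ℤ.+-mono-≤ (proj₁ (Π⁻-bounds γ∈Π⁻ k)) (ℤ.≤-refl {1ℤ}))) ,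
          D-⊕⊛c γ 1ℤ
      where
      shifted : IsRoot γ → IsRoot (γ ⊕ 1ℤ ⊛ c)
      shifted (root a≢b eq) = root a≢b λ k → trans (D-⊕⊛c γ 1ℤ k) (eq k)

  -- Reachability and length of the two-factor products.

  module _ (σ : Split) where
    open Split σ

    private
      β-bounded : Bounded β
      β-bounded = Boundedˡ β γ (nonneg γ-pos) (c-bounded sum≡c)

      γ-bounded : Bounded γ
      γ-bounded = Boundedʳ β γ (nonneg β-pos) (c-bounded sum≡c)

      disjoint : Disjoint β γ
      disjoint = Disjoint-⊕ β γ (nonneg β-pos) (nonneg γ-pos) (c-bounded sum≡c)

    split-reachable : s β ∘ s γ ∈ Reachable 𝐜 id
    split-reachable = ∘-Waff β∈ (s-Waff γ-pos γ-bounded) , id , id-Waff , done (λ _ → refl) , β ⊕ (γ ⊕ 𝟎) ,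
      (id-Waff , β∈ , PosRoot⇒Πaff-re⁺ β-pos , λ _ → refl) ∷
      (β∈ , ∘-Waff β∈ (s-Waff γ-pos γ-bounded) , PosRoot⇒Πaff-re⁺ γ-pos , λ _ → refl) ∷ [] (λ _ → refl) ,
      pointwise λ k → ℤ.≤-reflexive (trans (cong (λ x → lookup x k) (trans (cong (β ⊕_) (⊕-identityʳ γ)) sum≡c))
          (trans (c-at k) (sym (𝐜-at k))))
      where
      β∈ : s β ∈ Waff
      β∈ = s-Waff β-pos β-bounded
      pointwise : ∀ {n} {μ ν : Qaff n} → (∀ k → lookup μ k ℤ.≤ lookup ν k) → μ ≤Q ν
      pointwise {μ = Vec.[]} {Vec.[]} le = Pointwise.[]
      pointwise {μ = x Vec.∷ μ} {y Vec.∷ ν} le = le zero Pointwise.∷ pointwise (le ∘ suc)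

    -- The factors have lengths `2 ht β - 1` and `2 ht γ - 1`, and the heights add up to `ht c = n`,
    -- which gives `2(n-1)`. For the lower bound `Arc-MinLength` is applied first to `β` after `id`,
    -- then to `γ` after `s β`; the latter is allowed because `s β` keeps the simple roots in the
    -- support of `γ` nonnegative.
    split-length : HasLength (s β ∘ s γ) (2 ℕ.* (n ℕ.∸ 1))
    split-length =
      let ℓ , arc = PosRoot-arc β-pos β-bounded ; ℓ′ , arc′ = PosRoot-arc γ-pos γ-bounded
          is , len , eq = Arc-word arc ; js , len′ , eq′ = Arc-word arc′
          ℓ+ℓ′ = lengths ℓ ℓ′ (trans (collect (ht β) (ht γ)) (cong₂ ℤ._+_ (Arc-ht arc) (Arc-ht arc′)))
      in (is ++ js , trans (length-++ is) (trans (cong₂ ℕ._+_ len len′) ℓ+ℓ′) ,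
           λ μ → trans (eq (s γ μ)) (trans (cong (word is) (eq′ μ)) (sym (word-++ is js μ)))) ,
         subst (MinLength (s β ∘ s γ)) (trans (ℕ.+-comm ℓ′ (ℓ ℕ.+ 0))
             (trans (cong (ℕ._+ ℓ′) (ℕ.+-identityʳ ℓ)) ℓ+ℓ′))
           (Arc-MinLength {u = s β} arc′ (s-auto (isRoot β-pos)) image≥0
             (Arc-MinLength {u = id} arc id-auto (λ j _ → α-nonneg j) (λ _ _ → ℕ.z≤n)))
      where
      collect : ∀ x y → (x ℤ.+ y) ℤ.+ (x ℤ.+ y) ≡ (x ℤ.+ x) ℤ.+ (y ℤ.+ y)
      collect = solve-∀
      sum-1 : ∀ n (f : Fin n → ℤ) → (∀ k → f k ≡ 1ℤ) → sum f ≡ + n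
      sum-1 zero    f _  = refl
      sum-1 (suc n) f eq = cong₂ ℤ._+_ (eq zero) (sum-1 n (f ∘ suc) (eq ∘ suc))
      ht-sum : ht β ℤ.+ ht γ ≡ + n
      ht-sum = trans (sym (ht-⊕ β γ)) (trans (cong ht sum≡c) (sum-1 n (lookup c) c-at))
      lengths : ∀ ℓ ℓ′ → (ht β ℤ.+ ht γ) ℤ.+ (ht β ℤ.+ ht γ) ≡ + suc ℓ ℤ.+ + suc ℓ′ → ℓ ℕ.+ ℓ′ ≡ 2 ℕ.* (n ℕ.∸ 1)
      lengths ℓ ℓ′ e = halve 3≤n (ℤ.+-injective (trans (sym e) (cong₂ ℤ._+_ ht-sum ht-sum)))
        where
        halve : ∀ {n} → 3 ℕ.≤ n → suc ℓ ℕ.+ suc ℓ′ ≡ n ℕ.+ n → ℓ ℕ.+ ℓ′ ≡ 2 ℕ.* (n ℕ.∸ 1)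
        halve {suc n} _ e = ℕ.suc-injective (ℕ.suc-injective (trans (cong suc (sym (ℕ.+-suc ℓ ℓ′)))
          (trans e (cong suc (trans (ℕ.+-suc n n) (cong (λ x → suc (n ℕ.+ x)) (sym (ℕ.+-identityʳ n))))))))
      image≥0 : ∀ j → lookup γ j ≢ 0ℤ → Nonneg (s β (α j))
      image≥0 j γⱼ≢0 = s-nonneg β (α j) (nonneg β-pos) (α-nonneg j) (α-disjoint j β (zero-at (disjoint j)))
        where
        zero-at : lookup β j ≡ 0ℤ ⊎ lookup γ j ≡ 0ℤ → lookup β j ≡ 0ℤ
        zero-at (inj₁ e) = e
        zero-at (inj₂ e) = contradiction e γⱼ≢0

  -- The translations are exactly the maximal reachable elements.

  t-split : {γ : Qaff n} → γ ∈ Π → ∃[ σ ] s (Split.β σ) ∘ s (Split.γ σ) ≗ t γ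
  t-split {γ} γ∈Π = let σ , eq = Π-split γ∈Π in σ , λ μ → trans (s-s-t σ μ) (t-cong (Split.γ σ) γ eq μ)

  t-reachable : {γ : Qaff n} → γ ∈ Π → t γ ∈ Reachable 𝐜 id
  t-reachable γ∈Π = let σ , eq = t-split γ∈Π in Reachable-respʳ eq (split-reachable σ)

  t-length : {γ : Qaff n} → γ ∈ Π → HasLength (t γ) (2 ℕ.* (n ℕ.∸ 1))
  t-length γ∈Π = let σ , eq = t-split γ∈Π in HasLength-≗ eq (split-length σ)

  Γ⇒t : {w : Map n} → w ∈ Γ 𝐜 id → ∃[ γ ] (γ ∈ Π × w ≗ t γ)
  Γ⇒t (w-reach , w-max) =
    let γ , γ∈Π , w≤tγ = Reachable⇒≤ᴮt w-reach in γ , γ∈Π , w-max (t γ) (t-reachable γ∈Π) w≤tγ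

  -- A reachable `v` above `w` lies below some `t γ′`, whose length is that of `w`. So `v` is no
  -- longer than `w`, and the relation between them is an equality.
  t⇒Γ : {w : Map n} {γ : Qaff n} → γ ∈ Π → w ≗ t γ → w ∈ Γ 𝐜 id
  t⇒Γ {w} {γ} γ∈Π w≗tγ = Reachable-respʳ (λ μ → sym (w≗tγ μ)) (t-reachable γ∈Π) , λ v v-reach w≤v →
    let γ′ , γ′∈Π , v≤tγ′ = Reachable⇒≤ᴮt v-reach ; l , v-length = Waff-length (proj₁ v-reach) in
    ≤ᴮ-length-≗ w≤v (HasLength-≗ (λ μ → sym (w≗tγ μ)) (t-length γ∈Π)) v-length
        (≤ᴮ-length v≤tγ′ v-length (t-length γ′∈Π))

  -- Counting the translations.

  t-form : {γ γ′ : Qaff n} → Fin n → t γ ≗ t γ′ → ∀ μ → ⟨ γ , μ ⟩ ≡ ⟨ γ′ , μ ⟩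
  t-form {γ} {γ′} k eq μ = cancel (lookup μ k) ⟨ γ , μ ⟩ ⟨ γ′ , μ ⟩
    (trans (sym (t-at γ)) (trans (cong (λ x → lookup x k) (eq μ)) (t-at γ′)))
    where
    t-at : ∀ γ → lookup (t γ μ) k ≡ lookup μ k ℤ.- ⟨ γ , μ ⟩
    t-at γ = trans (⊖⊛-at μ ⟨ γ , μ ⟩ c k)
        (cong (ℤ._-_ (lookup μ k)) (trans (cong (ℤ._*_ ⟨ γ , μ ⟩) (c-at k)) (ℤ.*-identityʳ ⟨ γ , μ ⟩)))
    cancel : ∀ x a b → x ℤ.- a ≡ x ℤ.- b → a ≡ b
    cancel x a b e = trans (recover x a) (trans (cong (ℤ._-_ x) e) (sym (recover x b)))
      where
      recover : ∀ x a → a ≡ x ℤ.- (x ℤ.- a)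
      recover = solve-∀

  -- Equal translations give `⟨ γ′ , γ ⟩ = ⟨ γ , γ ⟩ = 2`, and `ε_p - ε_q` has scalar product 2 with
  -- `ε_a - ε_b` only when the two pairs of indices agree.
  t-injective : {γ γ′ : Qaff n} ((root {a} {b} _ _) : IsRoot γ) ((root {p} {q} _ _) : IsRoot γ′) → t γ ≗ t γ′ →
      (a ≡ p) × (b ≡ q)
  t-injective {γ} {γ′} r@(root {a} {b} a≢b eq) r′@(root {p} {q} p≢q eq′) t≗ = by-cases (a ≟ p) (b ≟ q)
    where
    pairing : (δ p a ℤ.- δ q a) ℤ.- (δ p b ℤ.- δ q b) ≡ + 2
    pairing = trans (sym (trans (form-root γ′ r) (cong₂ ℤ._-_ (eq′ a) (eq′ b))))
        (trans (sym (t-form {γ} {γ′} a t≗ γ)) (root-norm r))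
    ≤1 : ∀ {x y z} → x ℤ.≤ 1ℤ → 0ℤ ℤ.≤ y → 0ℤ ℤ.≤ z → (x ℤ.- y) ℤ.- z ℤ.≤ 1ℤ
    ≤1 x≤1 0≤y 0≤z = ℤ.+-mono-≤ (ℤ.+-mono-≤ x≤1 (ℤ.neg-mono-≤ 0≤y)) (ℤ.neg-mono-≤ 0≤z)
    ¬2≤1 : ∀ {x} → x ≡ + 2 → ¬ x ℤ.≤ 1ℤ
    ¬2≤1 refl (ℤ.+≤+ (ℕ.s≤s ()))
    by-cases : Dec (a ≡ p) → Dec (b ≡ q) → (a ≡ p) × (b ≡ q)
    by-cases (yes a≡p) (yes b≡q) = a≡p , b≡q
    by-cases (no a≢p) _ = contradiction
      (subst (ℤ._≤ 1ℤ) (sym (trans (cong (λ x → (x ℤ.- δ q a) ℤ.- (δ p b ℤ.- δ q b)) (δ-≢ a≢p))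
          (regroup (δ q a) (δ p b) (δ q b)))) (≤1 (δ≤1 q b) (0≤δ q a) (0≤δ p b)))
      (¬2≤1 pairing)
      where
      regroup : ∀ x y z → (0ℤ ℤ.- x) ℤ.- (y ℤ.- z) ≡ (z ℤ.- x) ℤ.- y
      regroup = solve-∀
    by-cases (yes _) (no b≢q) = contradiction
      (subst (ℤ._≤ 1ℤ) (sym (trans (cong (λ x → (δ p a ℤ.- δ q a) ℤ.- (δ p b ℤ.- x)) (δ-≢ b≢q))
          (regroup (δ p a) (δ q a) (δ p b)))) (≤1 (δ≤1 p a) (0≤δ q a) (0≤δ p b)))
      (¬2≤1 pairing)
      where
      regroup : ∀ x y z → (x ℤ.- y) ℤ.- (z ℤ.- 0ℤ) ≡ (x ℤ.- y) ℤ.- z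
      regroup = solve-∀

  Γ-cardinality : HasCardinality (Γ {n} 𝐜 id) (n ℕ.* (n ℕ.∸ 1))
  Γ-cardinality = record
    { to        = λ i → t (γ i) , t⇒Γ (γ∈Π i) (λ _ → refl)
    ; cong      = λ { refl _ → refl }
    ; bijective = (λ {i} {j} → injective i j) , surjective
    }
    where
    chosen : ∀ i → ∃[ γ ] (γ ∈ Π × ∀ k → D γ k ≡ δ (proj₁ (pair n i)) k ℤ.- δ (proj₂ (pair n i)) k)
    chosen i = Π-D (proj₁ (pair n i)) (proj₂ (pair n i)) (pair-≢ n i)
    γ : Fin (n ℕ.* (n ℕ.∸ 1)) → Qaff n
    γ i = proj₁ (chosen i)
    γ∈Π : ∀ i → γ i ∈ Π
    γ∈Π i = proj₁ (proj₂ (chosen i))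
    γ-root : ∀ i → IsRoot (γ i)
    γ-root i = root (pair-≢ n i) (proj₂ (proj₂ (chosen i)))
    injective : ∀ i j → t (γ i) ≗ t (γ j) → i ≡ j
    injective i j eq = let e , e′ = t-injective (γ-root i) (γ-root j) eq in pair-injective n i j (cong₂ _,_ e e′)
    surjective : ∀ ((w , w∈Γ) : ∃[ w ] w ∈ Γ 𝐜 id) → ∃[ i ] (∀ {j} → j ≡ i → t (γ j) ≗ w)
    surjective (w , w∈Γ) = let γ′ , γ′∈Π , w≗t = Γ⇒t w∈Γ in preimage γ′ (Π-root γ′∈Π) w≗t
      where
      preimage : ∀ γ′ → IsRoot γ′ → w ≗ t γ′ → ∃[ i ] (∀ {j} → j ≡ i → t (γ j) ≗ w)
      preimage γ′ (root {a} {b} a≢b eq) w≗t = let i , e = pair-surjective n a b a≢b in i , λ { refl μ →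
        trans (t-cong (γ i) γ′ (λ k → trans (proj₂ (proj₂ (chosen i)) k)
          (trans (cong (λ x → δ (proj₁ x) k ℤ.- δ (proj₂ x) k) e) (sym (eq k)))) μ) (sym (w≗t μ)) }

theorem1p6 : ∀ (n : ℕ) → 3 ≤ n →
    (Γ {n} 𝐜 id ≐ (λ w → ∃[ γ ] γ ∈ Π × w ≗ t γ)) ×
    HasCardinality (Γ {n} 𝐜 id) (n * (n ∸ 1)) ×
    (∀ w → w ∈ Γ {n} 𝐜 id → HasLength w (2 * (n ∸ 1)))
theorem1p6 n 3≤n =
  (Γ⇒t 3≤n , λ (γ , γ∈Π , w≗t) → t⇒Γ 3≤n γ∈Π w≗t) , Γ-cardinality 3≤n ,
  λ w w∈Γ → let γ , γ∈Π , w≗t = Γ⇒t 3≤n w∈Γ in HasLength-≗ 3≤n (λ μ → sym (w≗t μ)) (t-length 3≤n γ∈Π)
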